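{- For $n\ge0$ let ${}^{\ell}B_n(q,Y_0,Y_1,Z)$ be defined by the identity of formal power series in $u$ $$\sum_{n\ge 0}\frac{u^n}{(-Zq;q)_n\,(q;q)_n}\,{}^{\ell}B_n(q,Y_0,Y_1,Z)=\Bigl(1-\frac{u}{1-q}\Bigr)^{ -1}(u;q)_\infty\Bigl(\sum_{n\ge 0}\frac{(-qY_0^{ -1}Y_1Z;q)_n\,(uY_0)^n}{(-Zq;q)_n\,(q;q)_n}\Bigr).$$ Then for every $n\ge0$, $${}^{\ell}B_n(q,Y_0,Y_1,Z)=\sum_{w\in B_n}q^{\ell(w)}\,Y_0^{\mathrm{pix}^+w}\,Y_1^{\mathrm{pix}^-w}\,Z^{\mathrm{neg}\,w}.$$
   Context: $(a;q)_0=1$, $(a;q)_n=(1-a)(1-aq)\cdots(1-aq^{n-1})$ for $n\ge1$, and $(a;q)_\infty=\prod_{n\ge1}(1-aq^{n-1})$. $B_n$ is the set of signed permutations of order $n$: words $w=x_1\cdots x_n$ with $x_i\in\{ -n,\dots,-1,1,\dots,n\}$ and $|x_1|\cdots|x_n|$ a permutation of $12\cdots n$. $\mathrm{neg}\,w$ is the number of negative letters of $w$. The length of $w$ is $\ell(w)=\mathrm{inv}\,w+\sum_{i:\,x_i<0}|x_i|$, where $\mathrm{inv}\,w=\#\{(i,j):1\le i<j\le n,\ x_i>x_j\}$ (this is the Coxeter length function of $B_n$). A word $x_1\cdots x_m$ of distinct integers is a desarrangement if there is $k\ge1$ with $x_1>x_2>\cdots>x_{2k}$ and $x_{2k}<x_{2k+1}$,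 with convention $x_{m+1}=\infty$; the empty word is also a desarrangement. Every $w\in B_n$ has a unique factorization $w=w^-w^+w^d$ where $w^d$ is the longest right factor of $w$ that is a desarrangement, $w^-$ is an increasing word of negative letters and $w^+$ an increasing word of positive letters; $\mathrm{pix}^-w$ and $\mathrm{pix}^+w$ are the lengths of $w^-$ and $w^+$. -}

module Defs where

open import Data.Nat as ℕ using (ℕ; zero; suc)
open import Data.Integer as ℤ using (ℤ; +_; -[1+_]; ∣_∣; _≤ᵇ_)
open import Data.Bool using (Bool; true; false; not; _∧_; if_then_else_)
open import Data.List using (List; []; _∷_; map; concatMap; length; upTo; downFrom; _++_; foldr)
open import Data.Product using (_×_; _,_; proj₁; proj₂)
open import Relation.Binary.PropositionalEquality using (_≡_)

-- Formal power series: a series in one variable over A is its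
-- coefficient sequence ℕ → A.  Multivariate series are nested.

record Ops (A : Set) : Set where
  field
    zr  : A
    one : A
    add : A → A → A
    mul : A → A → A
    neg : A → A
    -- inverse; only ever applied to elements with constant term 1
    inv : A → A

PS : Set → Set
PS A = ℕ → A

sumTo : {A : Set} → Ops A → ℕ → (ℕ → A) → A
sumTo O zero    f = f 0
sumTo O (suc n) f = Ops.add O (sumTo O n f) (f (suc n))

sumFrom1 : {A : Set} → Ops A → ℕ → (ℕ → A) → A
sumFrom1 O zero    f = Ops.zr O
sumFrom1 O (suc n) f = Ops.add O (sumFrom1 O n f) (f (suc n))

psOps : {A : Set} → Ops A → Ops (PS A)
psOps {A} O = record
  { zr  = λ _ → zr
  ; one = λ { zero → one ; (suc _) → zr }
  ; add = λ f g n → add (f n) (g n)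
  ; mul = λ f g n → sumTo O n (λ k → mul (f k) (g (n ℕ.∸ k)))
  ; neg = λ f n → neg (f n)
  ; inv = λ f n → invUpTo f n n
  }
  where
  open Ops O
  -- invUpTo f n m is the m-th coefficient of f⁻¹ for m ≤ n, computed by
  -- g₀ = (f₀)⁻¹,  gₘ = - g₀ · Σ_{k=1}^{m} f_k g_{m-k}
  invUpTo : PS A → ℕ → ℕ → A
  invUpTo f zero    m = inv (f 0)
  invUpTo f (suc n) m =
    if m ℕ.≤ᵇ n then invUpTo f n m
    else neg (mul (inv (f 0))
                  (sumFrom1 O (suc n) (λ k → mul (f k) (invUpTo f n (suc n ℕ.∸ k)))))

-- integers; the inverse is the identity, which is correct on the units ±1
ℤOps : Ops ℤ
ℤOps = record
  { zr = + 0 ; one = + 1 ; add = ℤ._+_ ; mul = ℤ._*_ ; neg = ℤ.-_ ; inv = λ x → x }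

embed : {A : Set} → Ops A → A → PS A
embed O a zero    = a
embed O a (suc _) = Ops.zr O

var : {A : Set} → Ops A → PS A
var O (suc zero) = Ops.one O
var O _          = Ops.zr O

-- Variables (from the innermost):  Z, Y₁, Y₀, q, u.
-- R₄ = ℤ[[q,Y₀,Y₁,Z]] (q outermost),  R₅ = R₄[[u]].

R₁ R₂ R₃ R₄ R₅ : Set
R₁ = PS ℤ
R₂ = PS R₁
R₃ = PS R₂
R₄ = PS R₃
R₅ = PS R₄

O₁ : Ops R₁
O₁ = psOps ℤOps
O₂ : Ops R₂
O₂ = psOps O₁
O₃ : Ops R₃
O₃ = psOps O₂
O₄ : Ops R₄
O₄ = psOps O₃
O₅ : Ops R₅
O₅ = psOps O₄

Zv Y₁v Y₀v qv : R₄
Zv  = embed O₃ (embed O₂ (embed O₁ (var ℤOps)))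
Y₁v = embed O₃ (embed O₂ (var O₁))
Y₀v = embed O₃ (var O₂)
qv  = var O₃

uv : R₅
uv = var O₄

module _ {A : Set} (O : Ops A) where
  open Ops O
  pow : A → ℕ → A
  pow a zero    = one
  pow a (suc n) = mul (pow a n) a

  prodTo : ℕ → (ℕ → A) → A
  prodTo zero    f = one
  prodTo (suc n) f = mul (prodTo n f) (f n)

  sub : A → A → A
  sub a b = add a (neg b)

  sumList : List A → A
  sumList = foldr add zr

open Ops

qPoch : R₄ → ℕ → R₄
qPoch a n = prodTo O₄ n (λ i → sub O₄ (one O₄) (mul O₄ a (pow O₄ qv i)))

den : ℕ → R₄
den n = mul O₄ (qPoch (neg O₄ (mul O₄ Zv qv)) n) (qPoch qv n)

-- (-q Y₀⁻¹ Y₁ Z;q)_n Y₀ⁿ  =  ∏_{i<n} (Y₀ + q^{i+1} Y₁ Z)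
numer : ℕ → R₄
numer n = prodTo O₄ n (λ i → add O₄ Y₀v (mul O₄ (pow O₄ qv (suc i)) (mul O₄ Y₁v Zv)))

sumSeries : R₅
sumSeries n = mul O₄ (numer n) (inv O₄ (den n))

-- (u;q)_∞ : the coefficient of u^a q^b is that of the finite product
-- ∏_{i ≤ b} (1 - u qⁱ), which is stable for all larger truncations
uqFin : ℕ → R₅
uqFin N = prodTo O₅ N (λ i → sub O₅ (one O₅) (mul O₅ uv (embed O₄ (pow O₄ qv i))))

uqInf : R₅
uqInf a b = uqFin (suc b) a b

geomFactor : R₅
geomFactor = inv O₅ (sub O₅ (one O₅) (mul O₅ uv (embed O₄ (inv O₄ (sub O₄ (one O₄) qv)))))

rhs : R₅
rhs = mul O₅ geomFactor (mul O₅ uqInf sumSeries)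

-- ˡB_n defined by the generating-function identity:
-- ˡB_n = (-Zq;q)_n (q;q)_n · [uⁿ] RHS
lB : ℕ → R₄
lB n = mul O₄ (den n) (rhs n)

_≈₄_ : R₄ → R₄ → Set
f ≈₄ g = ∀ a b c d → f a b c d ≡ g a b c d

infix 4 _<ᵇℤ_
_<ᵇℤ_ : ℤ → ℤ → Bool
x <ᵇℤ y = not (y ≤ᵇ x)

isNeg : ℤ → Bool
isNeg x = x <ᵇℤ (+ 0)

words : {A : Set} → ℕ → List A → List (List A)
words zero    as = [] ∷ []
words (suc n) as = concatMap (λ x → map (x ∷_) (words n as)) as

alphabet : ℕ → List ℤ
alphabet n = map (λ k → -[1+ k ]) (downFrom n) ++ map (λ k → + suc k) (upTo n)

elemℕ : ℕ → List ℕ → Bool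
elemℕ x []       = false
elemℕ x (y ∷ ys) = if x ℕ.≡ᵇ y then true else elemℕ x ys

distinct : List ℕ → Bool
distinct []       = true
distinct (x ∷ xs) = not (elemℕ x xs) ∧ distinct xs

filterB : {A : Set} → (A → Bool) → List A → List A
filterB p []       = []
filterB p (x ∷ xs) = if p x then x ∷ filterB p xs else filterB p xs

-- B_n: words of length n over {-n..-1,1..n} whose absolute values are
-- pairwise distinct (hence a permutation of 1..n)
B : ℕ → List (List ℤ)
B n = filterB (λ w → distinct (map ∣_∣ w)) (words n (alphabet n))

count : {A : Set} → (A → Bool) → List A → ℕ
count p xs = length (filterB p xs)

negStat : List ℤ → ℕ
negStat = count isNeg

invStat : List ℤ → ℕ
invStat []       = 0
invStat (x ∷ xs) = count (λ y → y <ᵇℤ x) xs ℕ.+ invStat xs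

negAbsSum : List ℤ → ℕ
negAbsSum []       = 0
negAbsSum (x ∷ xs) = (if isNeg x then ∣ x ∣ else 0) ℕ.+ negAbsSum xs

len : List ℤ → ℕ
len w = invStat w ℕ.+ negAbsSum w

-- for a nonempty word, the least i with x_i < x_{i+1} (x_{m+1} = ∞)
firstAscent : List ℤ → ℕ
firstAscent []           = 0
firstAscent (x ∷ [])     = 1
firstAscent (x ∷ y ∷ ys) = if y <ᵇℤ x then suc (firstAscent (y ∷ ys)) else 1

evenB : ℕ → Bool
evenB zero          = true
evenB (suc zero)    = false
evenB (suc (suc n)) = evenB n

-- desarrangement: empty, or x₁ > … > x_{2k} < x_{2k+1} for some k ≥ 1,
-- i.e. the first ascent is at an even position
isDesarr : List ℤ → Bool
isDesarr []       = true
isDesarr (x ∷ xs) = evenB (firstAscent (x ∷ xs))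

-- w = v · w^d with w^d the longest desarrangement right factor
splitDes : List ℤ → List ℤ × List ℤ
splitDes []       = [] , []
splitDes (x ∷ xs) =
  if isDesarr (x ∷ xs) then ([] , x ∷ xs)
  else (x ∷ proj₁ (splitDes xs) , proj₂ (splitDes xs))

takeWhileB : {A : Set} → (A → Bool) → List A → List A
takeWhileB p []       = []
takeWhileB p (x ∷ xs) = if p x then x ∷ takeWhileB p xs else []

dropWhileB : {A : Set} → (A → Bool) → List A → List A
dropWhileB p []       = []
dropWhileB p (x ∷ xs) = if p x then dropWhileB p xs else x ∷ xs

-- v = w⁻ w⁺ with w⁻ the negative letters, w⁺ the positive ones
pixMinus pixPlus : List ℤ → ℕ
pixMinus w = length (takeWhileB isNeg (proj₁ (splitDes w)))
pixPlus  w = length (dropWhileB isNeg (proj₁ (splitDes w)))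

weight : List ℤ → R₄
weight w = mul O₄ (pow O₄ qv (len w))
            (mul O₄ (pow O₄ Y₀v (pixPlus w))
              (mul O₄ (pow O₄ Y₁v (pixMinus w)) (pow O₄ Zv (negStat w))))

Bpoly : ℕ → R₄
Bpoly n = sumList O₄ (map weight (B n))

{-# OPTIONS --safe #-}
module Submission where

-- Every word w is V D for exactly one increasing V and one desarrangement D, and once the sets
-- V and C of signed letters of the two factors are fixed, only the inversions inside D depend
-- on the order.  So, if K k is the inversion enumerator of the desarrangements of k letters,
-- the words with stem V and remaining letters C contribute the weight of
-- the split (V , C) times K |C|.  Summing over all signed splits with |V| = m and |C| = k, by
-- the position of the letter of largest absolute value, gives
--   (-Zq;q)ₙ (q;q)ₙ (-qY₀⁻¹Y₁Z;q)ₘ Y₀ᵐ / ((-Zq;q)ₘ (q;q)ₘ (q;q)ₖ),   n = m + k.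
-- The same count for unsigned splits shows that Σ K k uᵏ / (q;q)ₖ is the quotient of
-- Σ uⁿ / (1 - q)ⁿ, which enumerates permutations by inversions, by Σ uⁿ / (q;q)ₙ, which is
-- 1 / (u;q)_∞.

open import Defs
open import Algebra.Bundles using (CommutativeRing)
import Algebra.Solver.Ring.NaturalCoefficients.Default as SemiringSolver
open import Algebra.Structures using (IsCommutativeRing)
open import Data.Bool using (Bool; true; false; if_then_else_; T; not; _∧_)
open import Data.Empty using (⊥-elim)
open import Data.Integer as ℤ using (ℤ; +_; -[1+_]; ∣_∣)
import Data.Integer.Properties as ℤₚ
open import Data.List
  using (List; []; _∷_; _++_; _∷ʳ_; length; map; null; concatMap; upTo; downFrom)
open import Data.List.Properties using (length-++; map-++; upTo-∷ʳ; ++-assoc)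
open import Data.List.Relation.Binary.Permutation.Propositional as Perm
  using (_↭_; ↭-sym; ↭-trans)
open import Data.List.Relation.Binary.Permutation.Propositional.Properties as ↭ₚ using (↭-length)
open import Data.List.Relation.Ternary.Interleaving.Propositional
  using (Interleaving; []; consˡ; consʳ; toPermutation)
open import Data.List.Relation.Unary.All as All using (All; []; _∷_)
import Data.List.Relation.Unary.All.Properties as Allₚ
open import Data.List.Relation.Unary.AllPairs using (AllPairs; []; _∷_)
import Data.List.Relation.Unary.AllPairs.Properties as AllPairsₚ
open import Data.Nat as ℕ using (ℕ; zero; suc; _∸_; _≤_; _<_; z≤n; s≤s)
import Data.Nat.Properties as ℕₚ
open import Data.Product using (_×_; _,_; proj₁; proj₂)
open import Function using (_∘_; case_of_)
open import Level using (0ℓ)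
open import Relation.Binary.Core using (Rel)
open import Relation.Binary.PropositionalEquality as ≡ using (_≡_; refl)
import Relation.Binary.Reasoning.Setoid as SetoidReasoning
open import Relation.Nullary using (¬_)

-- Antidiagonal sums and rings of power series

-- The sum over signed splits has a closed form because inserting the letter n or -n into one of the
-- two factors multiplies the weight by a quantity that depends only on the sizes of the factors, so
-- the sum runs over weighted lattice paths, and a Pascal-type recursion evaluates it. The
-- enumerator of desarrangements is never computed from the words. `K` is defined as a coefficient
-- of the quotient of series. It is the inversion enumerator by uniqueness: both satisfy a relation
-- over splits whose term with empty stem determines the value at a set from the values at smaller
-- sets. All closed forms are cleared of denominators; division enters only through elements given
-- together with the equation that makes them inverses. Series are functions, equal when their
-- coefficients are. Hence the argument is carried out over a commutative ring with an arbitrary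
-- equivalence as equality, which covers the integers and every level of nested series. The algebra
-- holds for any element q of such a ring; only the infinite product requires q to be a variable,
-- since its coefficients are found by truncation in q.

Lawful : {A : Set} → Ops A → Rel A 0ℓ → Set
Lawful O _≈_ =
  IsCommutativeRing _≈_ (Ops.add O) (Ops.mul O) (Ops.neg O) (Ops.zr O) (Ops.one O)

Pointwise : {A : Set} → Rel A 0ℓ → Rel (PS A) 0ℓ
Pointwise _≈_ f g = ∀ n → f n ≈ g n

module Sums {A : Set} {_∼_ : Rel A 0ℓ} (O : Ops A) (lawful : Lawful O _∼_) where

  commutativeRing : CommutativeRing 0ℓ 0ℓ
  commutativeRing = record { isCommutativeRing = lawful }

  open CommutativeRing commutativeRing hiding (refl; sym; trans; zero)
  private module C = CommutativeRing commutativeRing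
  open SetoidReasoning setoid
  open import Algebra.Properties.CommutativeSemigroup +-commutativeSemigroup
    using (interchange)

  -- The sum of `h m k` over m + k = n. Taking both indices as arguments removes the truncated
  -- subtraction of the product in `psOps`, and makes commutativity and associativity plain
  -- inductions.
  conv : ℕ → (ℕ → ℕ → A) → A
  conv zero    h = h 0 0
  conv (suc n) h = h 0 (suc n) + conv n (λ m k → h (suc m) k)

  conv-cong : ∀ n {h h′ : ℕ → ℕ → A} →
              (∀ m k → m ℕ.+ k ≡ n → h m k ≈ h′ m k) → conv n h ≈ conv n h′
  conv-cong zero    eq = eq 0 0 refl
  conv-cong (suc n) eq =
    +-cong (eq 0 (suc n) refl) (conv-cong n (λ m k p → eq (suc m) k (≡.cong suc p)))

  conv-last : ∀ n (h : ℕ → ℕ → A) →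
              conv (suc n) h ≈ conv n (λ m k → h m (suc k)) + h (suc n) 0
  conv-last zero    h = C.refl
  conv-last (suc n) h = begin
    h 0 (suc (suc n)) + conv (suc n) (λ m k → h (suc m) k)
      ≈⟨ +-congˡ (conv-last n (λ m k → h (suc m) k)) ⟩
    h 0 (suc (suc n)) + (conv n (λ m k → h (suc m) (suc k)) + h (suc (suc n)) 0)
      ≈⟨ +-assoc _ _ _ ⟨
    conv (suc n) (λ m k → h m (suc k)) + h (suc (suc n)) 0 ∎

  conv-comm : ∀ n (h : ℕ → ℕ → A) → conv n h ≈ conv n (λ m k → h k m)
  conv-comm zero    h = C.refl
  conv-comm (suc n) h = begin
    h 0 (suc n) + conv n (λ m k → h (suc m) k)  ≈⟨ +-congˡ (conv-comm n _) ⟩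
    h 0 (suc n) + conv n (λ m k → h (suc k) m)  ≈⟨ +-comm _ _ ⟩
    conv n (λ m k → h (suc k) m) + h 0 (suc n)  ≈⟨ conv-last n (λ m k → h k m) ⟨
    conv (suc n) (λ m k → h k m)                ∎

  conv-+ : ∀ n (h h′ : ℕ → ℕ → A) →
           conv n (λ m k → h m k + h′ m k) ≈ conv n h + conv n h′
  conv-+ zero    h h′ = C.refl
  conv-+ (suc n) h h′ = begin
    (h 0 (suc n) + h′ 0 (suc n)) + conv n (λ m k → h (suc m) k + h′ (suc m) k)
      ≈⟨ +-congˡ (conv-+ n _ _) ⟩
    (h 0 (suc n) + h′ 0 (suc n))
      + (conv n (λ m k → h (suc m) k) + conv n (λ m k → h′ (suc m) k))
      ≈⟨ interchange _ _ _ _ ⟩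
    conv (suc n) h + conv (suc n) h′ ∎

  conv-*ˡ : ∀ n a (h : ℕ → ℕ → A) → a * conv n h ≈ conv n (λ m k → a * h m k)
  conv-*ˡ zero    a h = C.refl
  conv-*ˡ (suc n) a h = C.trans (distribˡ _ _ _) (+-congˡ (conv-*ˡ n a _))

  conv-*ʳ : ∀ n a (h : ℕ → ℕ → A) → conv n h * a ≈ conv n (λ m k → h m k * a)
  conv-*ʳ zero    a h = C.refl
  conv-*ʳ (suc n) a h = C.trans (distribʳ _ _ _) (+-congˡ (conv-*ʳ n a _))

  conv-0 : ∀ n {h : ℕ → ℕ → A} → (∀ m k → m ℕ.+ k ≡ n → h m k ≈ 0#) → conv n h ≈ 0#
  conv-0 zero    eq = eq 0 0 refl
  conv-0 (suc n) eq =
    C.trans (+-cong (eq 0 (suc n) refl) (conv-0 n (λ m k p → eq (suc m) k (≡.cong suc p))))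
            (+-identityˡ 0#)

  conv-assoc : ∀ n (h : ℕ → ℕ → ℕ → A) →
               conv n (λ m k → conv m (λ i j → h i j k)) ≈
               conv n (λ i m → conv m (λ j k → h i j k))
  conv-assoc zero    h = C.refl
  conv-assoc (suc n) h = begin
    h 0 0 (suc n) + conv n (λ m k → h 0 (suc m) k + conv m (λ i j → h (suc i) j k))
      ≈⟨ +-congˡ (conv-+ n _ _) ⟩
    h 0 0 (suc n) + (conv n (λ m k → h 0 (suc m) k)
                     + conv n (λ m k → conv m (λ i j → h (suc i) j k)))
      ≈⟨ +-assoc _ _ _ ⟨
    conv (suc n) (h 0) + conv n (λ m k → conv m (λ i j → h (suc i) j k))
      ≈⟨ +-congˡ (conv-assoc n (λ i j k → h (suc i) j k)) ⟩
    conv (suc n) (h 0) + conv n (λ i m → conv m (λ j k → h (suc i) j k)) ∎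

  sumTo-cong : ∀ n {f g : ℕ → A} → (∀ k → k ≤ n → f k ≈ g k) → sumTo O n f ≈ sumTo O n g
  sumTo-cong zero    eq = eq 0 z≤n
  sumTo-cong (suc n) eq =
    +-cong (sumTo-cong n (λ k k≤n → eq k (ℕₚ.m≤n⇒m≤1+n k≤n))) (eq (suc n) ℕₚ.≤-refl)

  sumTo≈conv : ∀ n (h : ℕ → ℕ → A) → sumTo O n (λ k → h k (n ∸ k)) ≈ conv n h
  sumTo≈conv zero    h = C.refl
  sumTo≈conv (suc n) h = begin
    sumTo O n (λ k → h k (suc n ∸ k)) + h (suc n) (n ∸ n)
      ≈⟨ +-cong (sumTo-cong n (λ k k≤n → C.reflexive (≡.cong (h k) (ℕₚ.+-∸-assoc 1 k≤n))))
                (C.reflexive (≡.cong (h (suc n)) (ℕₚ.n∸n≡0 n))) ⟩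
    sumTo O n (λ k → h k (suc (n ∸ k))) + h (suc n) 0
      ≈⟨ +-congʳ (sumTo≈conv n (λ m k → h m (suc k))) ⟩
    conv n (λ m k → h m (suc k)) + h (suc n) 0
      ≈⟨ conv-last n h ⟨
    conv (suc n) h ∎

  sumFrom1≈sumTo : ∀ n (f : ℕ → A) → f 0 + sumFrom1 O n f ≈ sumTo O n f
  sumFrom1≈sumTo zero    f = +-identityʳ _
  sumFrom1≈sumTo (suc n) f = C.trans (C.sym (+-assoc _ _ _)) (+-congʳ (sumFrom1≈sumTo n f))

  sumFrom1-cong : ∀ n {f g : ℕ → A} → (∀ k → k < n → f (suc k) ≈ g (suc k)) →
                  sumFrom1 O n f ≈ sumFrom1 O n g
  sumFrom1-cong zero    eq = C.refl
  sumFrom1-cong (suc n) eq =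
    +-cong (sumFrom1-cong n (λ k k<n → eq k (ℕₚ.m<n⇒m<1+n k<n))) (eq n ℕₚ.≤-refl)

module PowerSeries {A : Set} {_∼_ : Rel A 0ℓ} (O : Ops A) (lawful : Lawful O _∼_) where

  open Sums O lawful
  open CommutativeRing commutativeRing hiding (refl; sym; trans; zero)
  private module C = CommutativeRing commutativeRing
  open SetoidReasoning setoid
  open import Algebra.Properties.Ring ring using (-‿distribʳ-*; -0#≈0#)

  open Ops (psOps O) public using () renaming (mul to infixl 7 _⊛_; inv to inverse; one to 𝟙)

  infix 4 _≋_
  _≋_ : Rel (PS A) 0ℓ
  _≋_ = Pointwise _≈_

  ⊛≈conv : ∀ f g n → (f ⊛ g) n ≈ conv n (λ m k → f m * g k)
  ⊛≈conv f g n = sumTo≈conv n (λ m k → f m * g k)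

  ⊛-cong : ∀ {f f′ g g′} → f ≋ f′ → g ≋ g′ → (f ⊛ g) ≋ (f′ ⊛ g′)
  ⊛-cong f≋f′ g≋g′ n = sumTo-cong n (λ k _ → *-cong (f≋f′ k) (g≋g′ (n ∸ k)))

  ⊛-comm : ∀ f g → (f ⊛ g) ≋ (g ⊛ f)
  ⊛-comm f g n = begin
    (f ⊛ g) n                   ≈⟨ ⊛≈conv f g n ⟩
    conv n (λ m k → f m * g k)  ≈⟨ conv-comm n _ ⟩
    conv n (λ m k → f k * g m)  ≈⟨ conv-cong n (λ m k _ → *-comm (f k) (g m)) ⟩
    conv n (λ m k → g m * f k)  ≈⟨ ⊛≈conv g f n ⟨
    (g ⊛ f) n                   ∎

  ⊛-assoc : ∀ f g h → ((f ⊛ g) ⊛ h) ≋ (f ⊛ (g ⊛ h))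
  ⊛-assoc f g h n = begin
    ((f ⊛ g) ⊛ h) n
      ≈⟨ ⊛≈conv (f ⊛ g) h n ⟩
    conv n (λ m k → (f ⊛ g) m * h k)
      ≈⟨ conv-cong n (λ m k _ → C.trans (*-congʳ (⊛≈conv f g m)) (conv-*ʳ m (h k) _)) ⟩
    conv n (λ m k → conv m (λ i j → (f i * g j) * h k))
      ≈⟨ conv-assoc n _ ⟩
    conv n (λ i m → conv m (λ j k → (f i * g j) * h k))
      ≈⟨ conv-cong n (λ i m _ → conv-cong m (λ j k _ → *-assoc (f i) (g j) (h k))) ⟩
    conv n (λ i m → conv m (λ j k → f i * (g j * h k)))
      ≈⟨ conv-cong n (λ i m _ → C.trans (*-congˡ (⊛≈conv g h m)) (conv-*ˡ m (f i) _)) ⟨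
    conv n (λ i m → f i * (g ⊛ h) m)
      ≈⟨ ⊛≈conv f (g ⊛ h) n ⟨
    (f ⊛ (g ⊛ h)) n ∎

  𝟙⊛ : ∀ f → (𝟙 ⊛ f) ≋ f
  𝟙⊛ f n = C.trans (⊛≈conv 𝟙 f n) (go n)
    where
    go : ∀ n → conv n (λ m k → 𝟙 m * f k) ≈ f n
    go zero    = *-identityˡ _
    go (suc n) = C.trans (+-cong (*-identityˡ _) (conv-0 n (λ m k _ → zeroˡ (f k)))) (+-identityʳ _)

  ⊛-distribˡ : ∀ f g h → (f ⊛ Ops.add (psOps O) g h) ≋ Ops.add (psOps O) (f ⊛ g) (f ⊛ h)
  ⊛-distribˡ f g h n = begin
    (f ⊛ Ops.add (psOps O) g h) n                      ≈⟨ ⊛≈conv f (Ops.add (psOps O) g h) n ⟩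
    conv n (λ m k → f m * (g k + h k))                 ≈⟨ conv-cong n (λ m k _ → distribˡ _ _ _) ⟩
    conv n (λ m k → f m * g k + f m * h k)             ≈⟨ conv-+ n _ _ ⟩
    conv n (λ m k → f m * g k) + conv n (λ m k → f m * h k)
      ≈⟨ +-cong (⊛≈conv f g n) (⊛≈conv f h n) ⟨
    (f ⊛ g) n + (f ⊛ h) n                              ∎

  psLawful : Lawful (psOps O) _≋_
  psLawful = record
    { isRing = record
      { +-isAbelianGroup = record
        { isGroup = record
          { isMonoid = record
            { isSemigroup = record
              { isMagma = record
                { isEquivalence = record
                  { refl  = λ _ → C.refl
                  ; sym   = λ p n → C.sym (p n)
                  ; trans = λ p q n → C.trans (p n) (q n)
                  }
                ; ∙-cong = λ p q n → +-cong (p n) (q n)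
                }
              ; assoc = λ f g h n → +-assoc _ _ _
              }
            ; identity = (λ f n → +-identityˡ _) , (λ f n → +-identityʳ _)
            }
          ; inverse = (λ f n → -‿inverseˡ _) , (λ f n → -‿inverseʳ _)
          ; ⁻¹-cong = λ p n → -‿cong (p n)
          }
        ; comm = λ f g n → +-comm _ _
        }
      ; *-cong = ⊛-cong
      ; *-assoc = ⊛-assoc
      ; *-identity = 𝟙⊛ , (λ f n → C.trans (⊛-comm f 𝟙 n) (𝟙⊛ f n))
      ; distrib = ⊛-distribˡ
                , (λ f g h n → C.trans (⊛-comm (Ops.add (psOps O) g h) f n)
                                (C.trans (⊛-distribˡ f g h n)
                                  (+-cong (⊛-comm f g n) (⊛-comm f h n))))
      }
    ; *-comm = ⊛-comm
    }

  private
    -- The recursion behind inv is local to psOps; J n k and X, Y are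
    -- recovered from its unfoldings by unification.
    inverse-suc′ : (f : PS A) (g : ℕ → A) (J Y : ℕ → ℕ → A) (X : ℕ → A) →
      (∀ n → g (suc n) ≡ (if suc n ℕ.≤ᵇ n then X n
                          else (- (Ops.inv O (f 0) * sumFrom1 O (suc n) (λ k → f k * J n k))))) →
      (∀ n → J n 1 ≡ g n) →
      (∀ n k → J (suc n) (suc (suc k)) ≡ (if (n ∸ k) ℕ.≤ᵇ n then J n (suc k) else Y n k)) →
      ∀ n → g (suc n) ≈ - (Ops.inv O (f 0) * sumFrom1 O (suc n) (λ k → f k * g (suc n ∸ k)))
    inverse-suc′ f g J Y X step J-1 J-suc n = C.trans (C.reflexive step′)
      (-‿cong (*-congˡ (sumFrom1-cong (suc n) (λ k k≤n →
        *-congˡ (C.reflexive (J-eq n k (ℕₚ.≤-pred k≤n)))))))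
      where
      step′ : g (suc n) ≡ - (Ops.inv O (f 0) * sumFrom1 O (suc n) (λ k → f k * J n k))
      step′ with suc n ℕ.≤ᵇ n in eq | step n
      ... | false | p = p
      ... | true  | _ with () ← ℕₚ.1+n≰n (ℕₚ.≤ᵇ⇒≤ (suc n) n (≡.subst T (≡.sym eq) _))

      J-eq : ∀ n k → k ≤ n → J n (suc k) ≡ g (n ∸ k)
      J-eq n       zero    _         = J-1 n
      J-eq (suc n) (suc k) (s≤s k≤n) with (n ∸ k) ℕ.≤ᵇ n in eq | J-suc n k
      ... | true  | p = ≡.trans p (J-eq n k k≤n)
      ... | false | _ with () ← ≡.subst T eq (ℕₚ.≤⇒≤ᵇ (ℕₚ.m∸n≤m n k))

  inverse-suc : ∀ f n → inverse f (suc n) ≈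
                - (Ops.inv O (f 0) * sumFrom1 O (suc n) (λ k → f k * inverse f (suc n ∸ k)))
  inverse-suc f = inverse-suc′ f (inverse f) _ _ _ (λ n → refl) (λ n → refl) (λ n k → refl)

  ⊛-inverseʳ : ∀ f → f 0 * Ops.inv O (f 0) ≈ 1# → (f ⊛ inverse f) ≋ 𝟙
  ⊛-inverseʳ f unit zero    = unit
  ⊛-inverseʳ f unit (suc n) = begin
    sumTo O (suc n) F                                ≈⟨ sumFrom1≈sumTo (suc n) F ⟨
    f 0 * inverse f (suc n) + S                      ≈⟨ +-congʳ (*-congˡ (inverse-suc f n)) ⟩
    f 0 * - (Ops.inv O (f 0) * S) + S                ≈⟨ +-congʳ (-‿distribʳ-* _ _) ⟨
    - (f 0 * (Ops.inv O (f 0) * S)) + S              ≈⟨ +-congʳ (-‿cong (*-assoc _ _ _)) ⟨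
    - (f 0 * Ops.inv O (f 0) * S) + S                ≈⟨ +-congʳ (-‿cong (*-congʳ unit)) ⟩
    - (1# * S) + S                                   ≈⟨ +-congʳ (-‿cong (*-identityˡ S)) ⟩
    - S + S                                          ≈⟨ -‿inverseˡ S ⟩
    0#                                               ∎
    where
    F : ℕ → A
    F k = f k * inverse f (suc n ∸ k)
    S : A
    S = sumFrom1 O (suc n) F

  private module S = CommutativeRing (Sums.commutativeRing (psOps O) psLawful)

  var⊛-suc : ∀ f n → (var O ⊛ f) (suc n) ≈ f n
  var⊛-suc f n = begin
    (var O ⊛ f) (suc n)                             ≈⟨ ⊛≈conv (var O) f (suc n) ⟩
    0# * f (suc n) + conv n (λ m k → var O (suc m) * f k)
      ≈⟨ C.trans (+-congʳ (zeroˡ _)) (+-identityˡ _) ⟩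
    conv n (λ m k → var O (suc m) * f k)
      ≈⟨ conv-cong n (λ m k _ → *-congʳ (var-suc m)) ⟩
    conv n (λ m k → 𝟙 m * f k)                      ≈⟨ ⊛≈conv 𝟙 f n ⟨
    (𝟙 ⊛ f) n                                       ≈⟨ 𝟙⊛ f n ⟩
    f n                                             ∎
    where
    var-suc : ∀ m → var O (suc m) ≈ 𝟙 m
    var-suc zero    = C.refl
    var-suc (suc m) = C.refl

  embed⊛ : ∀ c f n → (embed O c ⊛ f) n ≈ c * f n
  embed⊛ c f zero    = C.refl
  embed⊛ c f (suc n) = C.trans (⊛≈conv (embed O c) f (suc n))
    (C.trans (+-congˡ (conv-0 n (λ m k _ → zeroˡ _))) (+-identityʳ _))

  -- The polynomial 1 - c u, spelled as in `uqFin` and `geomFactor`, so that the factors occurring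
  -- there are instances of it by definition.
  linear : A → PS A
  linear c = sub (psOps O) 𝟙 (var O ⊛ embed O c)

  linear⊛ : ∀ c f → (linear c ⊛ f) S.≈ sub (psOps O) f (var O ⊛ (embed O c ⊛ f))
  linear⊛ c f = S.trans (S.distribʳ f 𝟙 _)
    (S.+-cong (S.*-identityˡ f) (S.trans (S.sym (-‿distribˡ-*S _ f)) (S.-‿cong (S.*-assoc _ _ f))))
    where open import Algebra.Properties.Ring S.ring using () renaming (-‿distribˡ-* to -‿distribˡ-*S)

  linear⊛-zero : ∀ c f → (linear c ⊛ f) 0 ≈ f 0
  linear⊛-zero c f = C.trans (linear⊛ c f 0)
    (C.trans (+-congˡ (C.trans (-‿cong (zeroˡ _)) -0#≈0#)) (+-identityʳ _))

  linear⊛-suc : ∀ c f n → (linear c ⊛ f) (suc n) ≈ f (suc n) + - (c * f n)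
  linear⊛-suc c f n = C.trans (linear⊛ c f (suc n))
    (+-congˡ (-‿cong (C.trans (var⊛-suc (embed O c ⊛ f) n) (embed⊛ c f n))))

-- Words and their statistics

<ᵇℤ-true : ∀ {x y} → x ℤ.< y → (x <ᵇℤ y) ≡ true
<ᵇℤ-true {x} {y} x<y with y ℤ.≤ᵇ x in eq
... | false = refl
... | true  = ⊥-elim (ℤₚ.<⇒≱ x<y (ℤₚ.≤ᵇ⇒≤ (≡.subst T (≡.sym eq) _)))

<ᵇℤ-false : ∀ {x y} → y ℤ.≤ x → (x <ᵇℤ y) ≡ false
<ᵇℤ-false {x} {y} y≤x with y ℤ.≤ᵇ x in eq
... | true  = refl
... | false = ⊥-elim (≡.subst T eq (ℤₚ.≤⇒≤ᵇ y≤x))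

bit : Bool → ℕ
bit b = if b then 1 else 0

module _ {X : Set} (p : X → Bool) where

  count-∷ : ∀ x xs → count p (x ∷ xs) ≡ bit (p x) ℕ.+ count p xs
  count-∷ x xs with p x
  ... | true  = refl
  ... | false = refl

  count-++ : ∀ xs ys → count p (xs ++ ys) ≡ count p xs ℕ.+ count p ys
  count-++ []       ys = refl
  count-++ (x ∷ xs) ys
    rewrite count-∷ x (xs ++ ys) | count-∷ x xs | count-++ xs ys =
    ≡.sym (ℕₚ.+-assoc (bit (p x)) _ _)

  count-none : ∀ {xs} → All (λ x → p x ≡ false) xs → count p xs ≡ 0
  count-none         []         = refl
  count-none {x ∷ xs} (eq ∷ eqs) rewrite eq = count-none eqs

  count-all : ∀ {xs} → All (λ x → p x ≡ true) xs → count p xs ≡ length xs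
  count-all         []         = refl
  count-all {x ∷ xs} (eq ∷ eqs) rewrite eq = ≡.cong suc (count-all eqs)

additive-↭ : {X : Set} (F : List X → ℕ) (f : X → ℕ) →
             (∀ x xs → F (x ∷ xs) ≡ f x ℕ.+ F xs) →
             ∀ {xs ys} → xs ↭ ys → F xs ≡ F ys
additive-↭ F f F-∷ Perm.refl         = refl
additive-↭ F f F-∷ (Perm.prep {xs} {ys} x p)
  rewrite F-∷ x xs | F-∷ x ys = ≡.cong (f x ℕ.+_) (additive-↭ F f F-∷ p)
additive-↭ F f F-∷ (Perm.swap {xs} {ys} x y p)
  rewrite F-∷ x (y ∷ xs) | F-∷ y xs | F-∷ y (x ∷ ys) | F-∷ x ys
        | additive-↭ F f F-∷ p
        | ≡.sym (ℕₚ.+-assoc (f x) (f y) (F ys)) | ≡.sym (ℕₚ.+-assoc (f y) (f x) (F ys))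
        = ≡.cong (ℕ._+ F ys) (ℕₚ.+-comm (f x) (f y))
additive-↭ F f F-∷ (Perm.trans p q)  = ≡.trans (additive-↭ F f F-∷ p) (additive-↭ F f F-∷ q)

count-↭ : {X : Set} (p : X → Bool) {xs ys : List X} → xs ↭ ys → count p xs ≡ count p ys
count-↭ p = additive-↭ (count p) (bit ∘ p) (count-∷ p)

≡ᵇ-sym : ∀ m n → (m ℕ.≡ᵇ n) ≡ (n ℕ.≡ᵇ m)
≡ᵇ-sym zero    zero    = refl
≡ᵇ-sym zero    (suc n) = refl
≡ᵇ-sym (suc m) zero    = refl
≡ᵇ-sym (suc m) (suc n) = ≡ᵇ-sym m n

≡ᵇ-refl : ∀ n → (n ℕ.≡ᵇ n) ≡ true
≡ᵇ-refl zero    = refl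
≡ᵇ-refl (suc n) = ≡ᵇ-refl n

≢⇒≡ᵇ-false : ∀ {m n} → ¬ m ≡ n → (m ℕ.≡ᵇ n) ≡ false
≢⇒≡ᵇ-false {m} {n} m≢n with m ℕ.≡ᵇ n in eq
... | false = refl
... | true  = ⊥-elim (m≢n (ℕₚ.≡ᵇ⇒≡ m n (≡.subst T (≡.sym eq) _)))

elemℕ-↭ : ∀ n {xs ys} → xs ↭ ys → elemℕ n xs ≡ elemℕ n ys
elemℕ-↭ n Perm.refl         = refl
elemℕ-↭ n (Perm.prep x p)   rewrite elemℕ-↭ n p = refl
elemℕ-↭ n (Perm.swap x y p) rewrite elemℕ-↭ n p with n ℕ.≡ᵇ x | n ℕ.≡ᵇ y
... | true  | true  = refl
... | true  | false = refl
... | false | true  = refl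
... | false | false = refl
elemℕ-↭ n (Perm.trans p q)  = ≡.trans (elemℕ-↭ n p) (elemℕ-↭ n q)

elemℕ-none : ∀ n {xs} → All (λ x → ¬ n ≡ x) xs → elemℕ n xs ≡ false
elemℕ-none n []           = refl
elemℕ-none n (n≢x ∷ n∉xs) rewrite ≢⇒≡ᵇ-false n≢x = elemℕ-none n n∉xs

distinct-↭ : ∀ {xs ys} → xs ↭ ys → distinct xs ≡ distinct ys
distinct-↭ Perm.refl         = refl
distinct-↭ (Perm.prep x p)   rewrite elemℕ-↭ x p | distinct-↭ p = refl
distinct-↭ (Perm.swap {xs} {ys} x y p)
  rewrite ≡ᵇ-sym y x | elemℕ-↭ x p | elemℕ-↭ y p | distinct-↭ p
  with x ℕ.≡ᵇ y | elemℕ x ys | elemℕ y ys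
... | true  | true  | true  = refl
... | true  | true  | false = refl
... | true  | false | true  = refl
... | true  | false | false = refl
... | false | true  | true  = refl
... | false | true  | false = refl
... | false | false | true  = refl
... | false | false | false = refl
distinct-↭ (Perm.trans p q)  = ≡.trans (distinct-↭ p) (distinct-↭ q)

absDistinct : List ℤ → Bool
absDistinct w = distinct (map ∣_∣ w)

absDistinct-↭ : ∀ {v w} → v ↭ w → absDistinct v ≡ absDistinct w
absDistinct-↭ p = distinct-↭ (↭ₚ.map⁺ ∣_∣ p)

absDistinct-repeat : ∀ x y w → ∣ x ∣ ≡ ∣ y ∣ → absDistinct (x ∷ y ∷ w) ≡ false
absDistinct-repeat x y w eq rewrite eq | ≡ᵇ-refl ∣ y ∣ = refl

Bounded : ℕ → List ℤ → Set
Bounded n = All (λ x → ∣ x ∣ ≤ n)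

absDistinct-new : ∀ x {w n} → ∣ x ∣ ≡ suc n → Bounded n w → absDistinct (x ∷ w) ≡ absDistinct w
absDistinct-new x eq bounded
  rewrite elemℕ-none ∣ x ∣ (Allₚ.map⁺ (All.map (λ y≤n x≡y →
            ℕₚ.<-irrefl (≡.trans (≡.sym x≡y) eq) (s≤s y≤n)) bounded)) = refl

alphabet-suc : ∀ n → alphabet (suc n) ≡ -[1+ n ] ∷ (alphabet n ∷ʳ + suc n)
alphabet-suc n = ≡.cong (-[1+ n ] ∷_) (≡.trans
  (≡.cong (map -[1+_] (downFrom n) ++_)
    (≡.trans (≡.cong (map (+_ ∘ suc)) (≡.sym (upTo-∷ʳ n))) (map-++ _ (upTo n) _)))
  (≡.sym (++-assoc (map -[1+_] (downFrom n)) _ _)))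

alphabet-bounded : ∀ n → Bounded n (alphabet n)
alphabet-bounded zero    = []
alphabet-bounded (suc n) rewrite alphabet-suc n =
  ℕₚ.≤-refl ∷ Allₚ.++⁺ (All.map ℕₚ.m≤n⇒m≤1+n (alphabet-bounded n)) (ℕₚ.≤-refl ∷ [])

-- Stems, inversions between two factors, and signed letter sets

stem : List ℤ → List ℤ
stem w = proj₁ (splitDes w)

precedes : ℤ → List ℤ → Bool
precedes x []      = true
precedes x (y ∷ _) = not (y <ᵇℤ x)

evenB-suc : ∀ n → evenB (suc n) ≡ not (evenB n)
evenB-suc zero          = refl
evenB-suc (suc zero)    = refl
evenB-suc (suc (suc n)) = evenB-suc n

-- Let y be the first letter of `w`. If y < x, the initial descent grows by one letter, so the
-- parity of the first ascent flips; otherwise the first ascent is at 1. Thus `x ∷ w` is a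
-- desarrangement exactly when y < x and `w` is not one, and then y is also the first letter of the
-- stem of `w`.
isDesarr-∷ : ∀ x w → isDesarr (x ∷ w) ≡ not (precedes x (stem w))
isDesarr-∷ x []       = refl
isDesarr-∷ x (y ∷ ys) with isDesarr (y ∷ ys) in desarr | y <ᵇℤ x in y<x
... | true  | true  rewrite evenB-suc (firstAscent (y ∷ ys)) | desarr = refl
... | true  | false = refl
... | false | true  rewrite evenB-suc (firstAscent (y ∷ ys)) | desarr | y<x = refl
... | false | false rewrite y<x = refl

stem-∷ : ∀ x w → stem (x ∷ w) ≡ (if precedes x (stem w) then x ∷ stem w else [])
stem-∷ x w rewrite isDesarr-∷ x w with precedes x (stem w)
... | true  = refl
... | false = refl

isDesarr≡null-stem : ∀ w → isDesarr w ≡ null (stem w)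
isDesarr≡null-stem []       = refl
isDesarr≡null-stem (x ∷ w)  with isDesarr (x ∷ w)
... | true  = refl
... | false = refl

below : ℤ → List ℤ → ℕ
below x = count (_<ᵇℤ x)

-- The inversions between a letter of `V` and a letter of `C` when all of `V` stands before all of
-- `C`; their number does not depend on the order inside either factor.
crossInv : List ℤ → List ℤ → ℕ
crossInv []      C = 0
crossInv (x ∷ V) C = below x C ℕ.+ crossInv V C

Sorted : List ℤ → Set
Sorted = AllPairs ℤ._<_

below-∷-> : ∀ {x y} C → x ℤ.< y → below y (x ∷ C) ≡ suc (below y C)
below-∷-> {x} {y} C x<y rewrite count-∷ (_<ᵇℤ y) x C | <ᵇℤ-true x<y = refl

below-none : ∀ {x C} → All (x ℤ.<_) C → below x C ≡ 0
below-none {x} x<C = count-none (_<ᵇℤ x) (All.map (λ x<y → <ᵇℤ-false (ℤₚ.<⇒≤ x<y)) x<C)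

below-all : ∀ {x C} → All (ℤ._< x) C → below x C ≡ length C
below-all {x} C<x = count-all (_<ᵇℤ x) (All.map <ᵇℤ-true C<x)

below-∷ʳ : ∀ x C y → below x (C ∷ʳ y) ≡ below x C ℕ.+ bit (y <ᵇℤ x)
below-∷ʳ x C y = ≡.trans (count-++ (_<ᵇℤ x) C (y ∷ []))
  (≡.cong (below x C ℕ.+_) (≡.trans (count-∷ (_<ᵇℤ x) y []) (ℕₚ.+-identityʳ _)))

crossInv-leastʳ : ∀ {a} V C → All (a ℤ.<_) V → crossInv V (a ∷ C) ≡ length V ℕ.+ crossInv V C
crossInv-leastʳ []      C []            = refl
crossInv-leastʳ {a} (x ∷ V) C (a<x ∷ a<V)
  rewrite below-∷-> C a<x | crossInv-leastʳ V C a<V =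
  ≡.cong suc (≡.trans (≡.sym (ℕₚ.+-assoc (below x C) _ _))
    (≡.trans (≡.cong (ℕ._+ crossInv V C) (ℕₚ.+-comm (below x C) (length V)))
             (ℕₚ.+-assoc (length V) _ _)))

crossInv-greatestʳ : ∀ {a} V C → All (ℤ._< a) V → crossInv V (C ∷ʳ a) ≡ crossInv V C
crossInv-greatestʳ []      C []            = refl
crossInv-greatestʳ {a} (x ∷ V) C (x<a ∷ V<a)
  rewrite below-∷ʳ x C a | <ᵇℤ-false (ℤₚ.<⇒≤ x<a) | ℕₚ.+-identityʳ (below x C)
        | crossInv-greatestʳ V C V<a = refl

crossInv-greatestˡ : ∀ {a} V C → All (ℤ._< a) C → crossInv (V ∷ʳ a) C ≡ crossInv V C ℕ.+ length C
crossInv-greatestˡ []      C C<a rewrite below-all C<a = ℕₚ.+-identityʳ _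
crossInv-greatestˡ (x ∷ V) C C<a rewrite crossInv-greatestˡ V C C<a =
  ≡.sym (ℕₚ.+-assoc (below x C) _ _)

interleaving-length : ∀ {V C A : List ℤ} → Interleaving V C A → length V ℕ.+ length C ≡ length A
interleaving-length {V} V⧺C = ≡.trans (≡.sym (length-++ V)) (≡.sym (↭-length (toPermutation V⧺C)))

interleaving-count : ∀ p {V C A : List ℤ} → Interleaving V C A →
                     count p A ≡ count p V ℕ.+ count p C
interleaving-count p {V} {C} i = ≡.trans (count-↭ p (toPermutation i)) (count-++ p V C)

interleaving-All : ∀ {P : ℤ → Set} {V C A} → Interleaving V C A → All P A → All P V × All P C
interleaving-All []        []         = [] , []
interleaving-All (consˡ i) (px ∷ pxs) = let pV , pC = interleaving-All i pxs in px ∷ pV , pC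
interleaving-All (consʳ i) (px ∷ pxs) = let pV , pC = interleaving-All i pxs in pV , px ∷ pC

interleaving-Sorted : ∀ {V C A} → Interleaving V C A → Sorted A → Sorted V × Sorted C
interleaving-Sorted []        []           = [] , []
interleaving-Sorted (consˡ i) (x<A ∷ sorted) =
  let sV , sC = interleaving-Sorted i sorted in proj₁ (interleaving-All i x<A) ∷ sV , sC
interleaving-Sorted (consʳ i) (x<A ∷ sorted) =
  let sV , sC = interleaving-Sorted i sorted in sV , proj₂ (interleaving-All i x<A) ∷ sC

record LetterSet (n : ℕ) (A : List ℤ) : Set where
  field
    size    : length A ≡ n
    sorted  : Sorted A
    bounded : Bounded n A
open LetterSet

∣x∣≤n⇒-n-1<x : ∀ {n} x → ∣ x ∣ ≤ n → -[1+ n ] ℤ.< x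
∣x∣≤n⇒-n-1<x (+ k)    _     = ℤ.-<+
∣x∣≤n⇒-n-1<x -[1+ k ] k<n   = ℤ.-<- k<n

∣x∣≤n⇒x<n+1 : ∀ {n} x → ∣ x ∣ ≤ n → x ℤ.< + suc n
∣x∣≤n⇒x<n+1 (+ k)    k≤n = ℤ.+<+ (s≤s k≤n)
∣x∣≤n⇒x<n+1 -[1+ k ] _   = ℤ.-<+

letterSet-[] : LetterSet 0 []
letterSet-[] = record { size = refl ; sorted = [] ; bounded = [] }

letterSet-neg : ∀ {n A} → LetterSet n A → LetterSet (suc n) (-[1+ n ] ∷ A)
letterSet-neg S = record
  { size    = ≡.cong suc (size S)
  ; sorted  = All.map (∣x∣≤n⇒-n-1<x _) (bounded S) ∷ sorted S
  ; bounded = ℕₚ.≤-refl ∷ All.map ℕₚ.m≤n⇒m≤1+n (bounded S)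
  }

letterSet-pos : ∀ {n A} → LetterSet n A → LetterSet (suc n) (A ∷ʳ + suc n)
letterSet-pos {n} {A} S = record
  { size    = ≡.trans (length-++ A) (≡.trans (ℕₚ.+-comm (length A) 1) (≡.cong suc (size S)))
  ; sorted  = AllPairsₚ.++⁺ (sorted S) ([] ∷ [])
                (All.map (λ b → ∣x∣≤n⇒x<n+1 _ b ∷ []) (bounded S))
  ; bounded = Allₚ.++⁺ (All.map ℕₚ.m≤n⇒m≤1+n (bounded S)) (ℕₚ.≤-refl ∷ [])
  }

negPart posPart : List ℤ → ℕ
negPart V = length (takeWhileB isNeg V)
posPart V = length (dropWhileB isNeg V)

negPart-∷ʳ : ∀ V k → negPart (V ∷ʳ + k) ≡ negPart V
negPart-∷ʳ []      k = refl
negPart-∷ʳ (x ∷ V) k with isNeg x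
... | true  = ≡.cong suc (negPart-∷ʳ V k)
... | false = refl

posPart-∷ʳ : ∀ V k → posPart (V ∷ʳ + k) ≡ suc (posPart V)
posPart-∷ʳ []      k = refl
posPart-∷ʳ (x ∷ V) k with isNeg x
... | true  = posPart-∷ʳ V k
... | false = ≡.cong suc (≡.trans (length-++ V) (ℕₚ.+-comm (length V) 1))

negAbsSum-↭ : ∀ {v w} → v ↭ w → negAbsSum v ≡ negAbsSum w
negAbsSum-↭ = additive-↭ negAbsSum (λ x → if isNeg x then ∣ x ∣ else 0) (λ _ _ → refl)

negStat-↭ : ∀ {v w} → v ↭ w → negStat v ≡ negStat w
negStat-↭ = count-↭ isNeg

precedes-least : ∀ {x V} → All (x ℤ.<_) V → precedes x V ≡ true
precedes-least []        = refl
precedes-least (x<y ∷ _) = ≡.cong not (<ᵇℤ-false (ℤₚ.<⇒≤ x<y))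

precedes⇒below : ∀ {x V} → Sorted V → precedes x V ≡ true → below x V ≡ 0
precedes⇒below {x} {[]}    _              _   = refl
precedes⇒below {x} {y ∷ V} (y<V ∷ _) x≤y rewrite count-∷ (_<ᵇℤ x) y V with y <ᵇℤ x in y≮x
... | false = count-none (_<ᵇℤ x) (All.map (λ {z} y<z → <ᵇℤ-false {z} {x}
  (ℤₚ.≤-trans (ℤₚ.≮⇒≥ (λ y<x → case ≡.trans (≡.sym (<ᵇℤ-true y<x)) y≮x of λ ())) (ℤₚ.<⇒≤ y<z))) y<V)

-- Sums over words, sublists, arrangements and splittings

module Enumeration {A : Set} {_∼_ : Rel A 0ℓ} (O : Ops A) (lawful : Lawful O _∼_) where

  open Sums O lawful
  open CommutativeRing commutativeRing hiding (refl; sym; trans; zero)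
  private module C = CommutativeRing commutativeRing
  open SetoidReasoning setoid
  open import Algebra.Properties.CommutativeSemigroup +-commutativeSemigroup
    using (interchange)

  when : Bool → A → A
  when b a = if b then a else 0#

  when-cong : ∀ b {a a′} → a ≈ a′ → when b a ≈ when b a′
  when-cong true  eq = eq
  when-cong false eq = C.refl

  when-+ : ∀ b a a′ → when b (a + a′) ≈ when b a + when b a′
  when-+ true  a a′ = C.refl
  when-+ false a a′ = C.sym (+-identityˡ 0#)

  module _ {X : Set} where

    ∑ : List X → (X → A) → A
    ∑ xs f = sumList O (map f xs)

    ∑-cong : ∀ xs {f g : X → A} → (∀ x → f x ≈ g x) → ∑ xs f ≈ ∑ xs g
    ∑-cong []       eq = C.refl
    ∑-cong (x ∷ xs) eq = +-cong (eq x) (∑-cong xs eq)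

    ∑-+ : ∀ xs (f g : X → A) → ∑ xs (λ x → f x + g x) ≈ ∑ xs f + ∑ xs g
    ∑-+ []       f g = C.sym (+-identityˡ 0#)
    ∑-+ (x ∷ xs) f g = C.trans (+-congˡ (∑-+ xs f g)) (interchange _ _ _ _)

    ∑-++ : ∀ xs ys (f : X → A) → ∑ (xs ++ ys) f ≈ ∑ xs f + ∑ ys f
    ∑-++ []       ys f = C.sym (+-identityˡ _)
    ∑-++ (x ∷ xs) ys f = C.trans (+-congˡ (∑-++ xs ys f)) (C.sym (+-assoc _ _ _))

    ∑-filterB : ∀ p xs (f : X → A) → ∑ (filterB p xs) f ≈ ∑ xs (λ x → when (p x) (f x))
    ∑-filterB p []       f = C.refl
    ∑-filterB p (x ∷ xs) f with p x
    ... | true  = +-congˡ (∑-filterB p xs f)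
    ... | false = C.trans (∑-filterB p xs f) (C.sym (+-identityˡ _))

    -- The four functionals sum over subsequences of length `k`, over choices of one entry with the
    -- remaining list, over orderings (when `n` is the length of `S`), and over splittings into two
    -- complementary subsequences. They are recursive functionals and not sums over lists of
    -- objects, so that an induction only has to change the summand.
    ΣSublists : ℕ → List X → (List X → A) → A
    ΣSublists zero    L       g = g []
    ΣSublists (suc k) []      g = 0#
    ΣSublists (suc k) (l ∷ L) g = ΣSublists k L (g ∘ (l ∷_)) + ΣSublists (suc k) L g

    ΣChoices : List X → (X → List X → A) → A
    ΣChoices []      h = 0#
    ΣChoices (a ∷ S) h = h a S + ΣChoices S (λ x S′ → h x (a ∷ S′))

    ΣArrangements : ℕ → List X → (List X → A) → A
    ΣArrangements zero    S f = f []
    ΣArrangements (suc n) S f = ΣChoices S (λ x S′ → ΣArrangements n S′ (f ∘ (x ∷_)))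

    ΣSplits : List X → (List X → List X → A) → A
    ΣSplits []      g = g [] []
    ΣSplits (a ∷ S) g = ΣSplits S (λ V C → g (a ∷ V) C) + ΣSplits S (λ V C → g V (a ∷ C))

    ΣSublists-cong : ∀ k L {g g′ : List X → A} {P : X → Set} → All P L →
                     (∀ S → All P S → g S ≈ g′ S) → ΣSublists k L g ≈ ΣSublists k L g′
    ΣSublists-cong zero    L       PL        eq = eq [] []
    ΣSublists-cong (suc k) []      PL        eq = C.refl
    ΣSublists-cong (suc k) (l ∷ L) (pl ∷ PL) eq =
      +-cong (ΣSublists-cong k L PL (λ S PS → eq (l ∷ S) (pl ∷ PS)))
             (ΣSublists-cong (suc k) L PL eq)

    ΣSublists-0 : ∀ k L → ΣSublists k L (λ _ → 0#) ≈ 0#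
    ΣSublists-0 zero    L       = C.refl
    ΣSublists-0 (suc k) []      = C.refl
    ΣSublists-0 (suc k) (l ∷ L) =
      C.trans (+-cong (ΣSublists-0 k L) (ΣSublists-0 (suc k) L)) (+-identityˡ 0#)

    ΣSublists-+ : ∀ k L (g g′ : List X → A) →
                  ΣSublists k L (λ S → g S + g′ S) ≈ ΣSublists k L g + ΣSublists k L g′
    ΣSublists-+ zero    L       g g′ = C.refl
    ΣSublists-+ (suc k) []      g g′ = C.sym (+-identityˡ 0#)
    ΣSublists-+ (suc k) (l ∷ L) g g′ =
      C.trans (+-cong (ΣSublists-+ k L _ _) (ΣSublists-+ (suc k) L g g′)) (interchange _ _ _ _)

    ΣSublists-≈ : ∀ k L {g g′ : List X → A} → (∀ S → g S ≈ g′ S) →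
                  ΣSublists k L g ≈ ΣSublists k L g′
    ΣSublists-≈ zero    L       eq = eq []
    ΣSublists-≈ (suc k) []      eq = C.refl
    ΣSublists-≈ (suc k) (l ∷ L) eq =
      +-cong (ΣSublists-≈ k L (λ S → eq (l ∷ S))) (ΣSublists-≈ (suc k) L eq)

    ΣSublists-∷ʳ : ∀ k L a (g : List X → A) →
      ΣSublists (suc k) (L ∷ʳ a) g ≈ ΣSublists k L (λ S → g (S ∷ʳ a)) + ΣSublists (suc k) L g
    ΣSublists-∷ʳ zero    []      a g = C.refl
    ΣSublists-∷ʳ (suc k) []      a g = C.refl
    ΣSublists-∷ʳ zero    (l ∷ L) a g = begin
      g (l ∷ []) + ΣSublists 1 (L ∷ʳ a) g        ≈⟨ +-congˡ (ΣSublists-∷ʳ zero L a g) ⟩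
      g (l ∷ []) + (g (a ∷ []) + ΣSublists 1 L g) ≈⟨ +-assoc _ _ _ ⟨
      g (l ∷ []) + g (a ∷ []) + ΣSublists 1 L g   ≈⟨ +-congʳ (+-comm _ _) ⟩
      g (a ∷ []) + g (l ∷ []) + ΣSublists 1 L g   ≈⟨ +-assoc _ _ _ ⟩
      g (a ∷ []) + (g (l ∷ []) + ΣSublists 1 L g) ∎
    ΣSublists-∷ʳ (suc k) (l ∷ L) a g =
      C.trans (+-cong (ΣSublists-∷ʳ k L a _) (ΣSublists-∷ʳ (suc k) L a g)) (interchange _ _ _ _)

    ΣChoices-+ : ∀ S (h h′ : X → List X → A) →
                 ΣChoices S (λ x S′ → h x S′ + h′ x S′) ≈ ΣChoices S h + ΣChoices S h′
    ΣChoices-+ []      h h′ = C.sym (+-identityˡ 0#)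
    ΣChoices-+ (a ∷ S) h h′ = C.trans (+-congˡ (ΣChoices-+ S _ _)) (interchange _ _ _ _)

    ΣChoices-*ˡ : ∀ S c (h : X → List X → A) → c * ΣChoices S h ≈ ΣChoices S (λ x S′ → c * h x S′)
    ΣChoices-*ˡ []      c h = zeroʳ c
    ΣChoices-*ˡ (a ∷ S) c h = C.trans (distribˡ _ _ _) (+-congˡ (ΣChoices-*ˡ S c _))

    ΣChoices-*ʳ : ∀ S c (h : X → List X → A) → ΣChoices S h * c ≈ ΣChoices S (λ x S′ → h x S′ * c)
    ΣChoices-*ʳ []      c h = zeroˡ c
    ΣChoices-*ʳ (a ∷ S) c h = C.trans (distribʳ _ _ _) (+-congˡ (ΣChoices-*ʳ S c _))

    -- A choice of `x` is a splitting whose first part is `x ∷ []`. Recording it as an interleaving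
    -- lets the same lemmas transfer sortedness, bounds and counts for choices and for splittings.
    ΣChoices-cong : ∀ S {h h′ : X → List X → A} →
                    (∀ x S′ → Interleaving (x ∷ []) S′ S → h x S′ ≈ h′ x S′) →
                    ΣChoices S h ≈ ΣChoices S h′
    ΣChoices-cong []      eq = C.refl
    ΣChoices-cong (a ∷ S) eq =
      +-cong (eq a S (consˡ (none S)))
             (ΣChoices-cong S (λ x S′ i → eq x (a ∷ S′) (consʳ i)))
      where
      none : ∀ S → Interleaving [] S S
      none []      = []
      none (x ∷ S) = consʳ (none S)

    ΣArrangements-+ : ∀ n S (f f′ : List X → A) →
      ΣArrangements n S (λ w → f w + f′ w) ≈ ΣArrangements n S f + ΣArrangements n S f′
    ΣArrangements-+ zero    S f f′ = C.refl
    ΣArrangements-+ (suc n) S f f′ =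
      C.trans (ΣChoices-cong S (λ x S′ _ → ΣArrangements-+ n S′ _ _)) (ΣChoices-+ S _ _)

    ΣArrangements-*ˡ : ∀ n S c (f : List X → A) →
      c * ΣArrangements n S f ≈ ΣArrangements n S (λ w → c * f w)
    ΣArrangements-*ˡ zero    S c f = C.refl
    ΣArrangements-*ˡ (suc n) S c f =
      C.trans (ΣChoices-*ˡ S c _) (ΣChoices-cong S (λ x S′ _ → ΣArrangements-*ˡ n S′ c _))

    ΣArrangements-cong : ∀ n S {f f′ : List X → A} → length S ≡ n →
      (∀ w → w ↭ S → f w ≈ f′ w) → ΣArrangements n S f ≈ ΣArrangements n S f′
    ΣArrangements-cong zero    []      _    eq = eq [] Perm.refl
    ΣArrangements-cong (suc n) S       size eq = ΣChoices-cong S (λ x S′ i →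
      ΣArrangements-cong n S′
        (ℕₚ.suc-injective (≡.trans (≡.sym (↭-length (toPermutation i))) size))
        (λ w w↭S′ → eq (x ∷ w) (↭-trans (Perm.prep x w↭S′) (↭-sym (toPermutation i)))))

    ΣSplits-cong : ∀ S {g g′ : List X → List X → A} →
      (∀ V C → Interleaving V C S → g V C ≈ g′ V C) → ΣSplits S g ≈ ΣSplits S g′
    ΣSplits-cong []      eq = eq [] [] []
    ΣSplits-cong (a ∷ S) eq =
      +-cong (ΣSplits-cong S (λ V C i → eq (a ∷ V) C (consˡ i)))
             (ΣSplits-cong S (λ V C i → eq V (a ∷ C) (consʳ i)))

    ΣSplits-0 : ∀ S → ΣSplits S (λ _ _ → 0#) ≈ 0#
    ΣSplits-0 []      = C.refl
    ΣSplits-0 (a ∷ S) = C.trans (+-cong (ΣSplits-0 S) (ΣSplits-0 S)) (+-identityˡ 0#)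

    ΣSplits-+ : ∀ S (g g′ : List X → List X → A) →
      ΣSplits S (λ V C → g V C + g′ V C) ≈ ΣSplits S g + ΣSplits S g′
    ΣSplits-+ []      g g′ = C.refl
    ΣSplits-+ (a ∷ S) g g′ = C.trans (+-cong (ΣSplits-+ S _ _) (ΣSplits-+ S _ _)) (interchange _ _ _ _)

    ΣSplits-*ˡ : ∀ S c (g : List X → List X → A) →
      c * ΣSplits S g ≈ ΣSplits S (λ V C → c * g V C)
    ΣSplits-*ˡ []      c g = C.refl
    ΣSplits-*ˡ (a ∷ S) c g =
      C.trans (distribˡ _ _ _) (+-cong (ΣSplits-*ˡ S c _) (ΣSplits-*ˡ S c _))

    ΣSplits-∷ʳ : ∀ S a (g : List X → List X → A) →
      ΣSplits (S ∷ʳ a) g ≈ ΣSplits S (λ V C → g (V ∷ʳ a) C) + ΣSplits S (λ V C → g V (C ∷ʳ a))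
    ΣSplits-∷ʳ []      a g = C.refl
    ΣSplits-∷ʳ (b ∷ S) a g =
      C.trans (+-cong (ΣSplits-∷ʳ S a _) (ΣSplits-∷ʳ S a _)) (interchange _ _ _ _)

    ΣSplits-null : ∀ S (g : List X → List X → A) →
      ΣSplits S g ≈ g [] S + ΣSplits S (λ V C → when (not (null V)) (g V C))
    ΣSplits-null []      g = C.sym (+-identityʳ _)
    ΣSplits-null (a ∷ S) g = begin
      ΣSplits S (λ V C → g (a ∷ V) C) + ΣSplits S (λ V C → g V (a ∷ C))
        ≈⟨ +-congˡ (ΣSplits-null S _) ⟩
      ΣSplits S (λ V C → g (a ∷ V) C)
        + (g [] (a ∷ S) + ΣSplits S (λ V C → when (not (null V)) (g V (a ∷ C))))
        ≈⟨ +-assoc _ _ _ ⟨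
      ΣSplits S (λ V C → g (a ∷ V) C) + g [] (a ∷ S)
        + ΣSplits S (λ V C → when (not (null V)) (g V (a ∷ C)))
        ≈⟨ +-congʳ (+-comm _ _) ⟩
      g [] (a ∷ S) + ΣSplits S (λ V C → g (a ∷ V) C)
        + ΣSplits S (λ V C → when (not (null V)) (g V (a ∷ C)))
        ≈⟨ +-assoc _ _ _ ⟩
      g [] (a ∷ S) + ΣSplits (a ∷ S) (λ V C → when (not (null V)) (g V C)) ∎

  ∑-map : ∀ {X Y : Set} (e : X → Y) xs (f : Y → A) → ∑ (map e xs) f ≡ ∑ xs (f ∘ e)
  ∑-map e []       f = refl
  ∑-map e (x ∷ xs) f = ≡.cong (λ s → f (e x) + s) (∑-map e xs f)

  ∑-concatMap : ∀ {X Y : Set} (e : X → List Y) xs (f : Y → A) →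
                ∑ (concatMap e xs) f ≈ ∑ xs (λ x → ∑ (e x) f)
  ∑-concatMap e []       f = C.refl
  ∑-concatMap e (x ∷ xs) f =
    C.trans (∑-++ (e x) (concatMap e xs) f) (+-congˡ (∑-concatMap e xs f))

  ∑-words-suc : ∀ {X : Set} n (L : List X) (f : List X → A) →
    ∑ (words (suc n) L) f ≈ ∑ L (λ x → ∑ (words n L) (f ∘ (x ∷_)))
  ∑-words-suc n L f = C.trans (∑-concatMap (λ x → map (x ∷_) (words n L)) L f)
    (∑-cong L (λ x → C.reflexive (∑-map (x ∷_) (words n L) f)))

  module _ {X : Set} where

    -- Choosing a letter x and then a set S amounts to choosing the set x ∷ S
    -- and then its element x, as long as p discards the case x ∈ S.
    ∑-ΣSublists : (p : List X → Bool) → (∀ {v w} → v ↭ w → p v ≡ p w) →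
      (∀ x w → p (x ∷ x ∷ w) ≡ false) → ∀ n L (h : X → List X → A) →
      ∑ L (λ x → ΣSublists n L (λ S → when (p (x ∷ S)) (h x S))) ≈
      ΣSublists (suc n) L (λ S → when (p S) (ΣChoices S h))
    ∑-ΣSublists p p-↭ p-dup n []      h = C.refl
    ∑-ΣSublists p p-↭ p-dup zero (l ∷ L) h =
      +-cong (when-cong (p (l ∷ [])) (C.sym (+-identityʳ _))) (∑-ΣSublists p p-↭ p-dup zero L h)
    ∑-ΣSublists p p-↭ p-dup (suc n) (l ∷ L) h = begin
      (ΣSublists n L (λ S → when (p (l ∷ l ∷ S)) (h l (l ∷ S))) + P)
        + ∑ L (λ x → ΣSublists n L (λ S → when (p (x ∷ l ∷ S)) (h x (l ∷ S)))
                     + ΣSublists (suc n) L (λ S → when (p (x ∷ S)) (h x S)))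
        ≈⟨ +-cong (+-congʳ (ΣSublists-≈ n L (λ S →
                     C.reflexive (≡.cong (λ b → when b (h l (l ∷ S))) (p-dup l S)))))
                  (∑-+ L _ _) ⟩
      (ΣSublists n L (λ _ → 0#) + P)
        + (∑ L (λ x → ΣSublists n L (λ S → when (p (x ∷ l ∷ S)) (h x (l ∷ S))))
           + ∑ L (λ x → ΣSublists (suc n) L (λ S → when (p (x ∷ S)) (h x S))))
        ≈⟨ +-cong (C.trans (+-congʳ (ΣSublists-0 n L)) (+-identityˡ P))
                  (+-cong (∑-cong L (λ x → ΣSublists-≈ n L (λ S → C.reflexive
                            (≡.cong (λ b → when b (h x (l ∷ S))) (p-↭ (Perm.swap x l Perm.refl))))))
                          (∑-ΣSublists p p-↭ p-dup (suc n) L h)) ⟩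
      P + (∑ L (λ x → ΣSublists n L (λ S → when (p (l ∷ x ∷ S)) (h x (l ∷ S)))) + R)
        ≈⟨ +-congˡ (+-congʳ (∑-ΣSublists (p ∘ (l ∷_)) (p-↭ ∘ Perm.prep l) dup n L
                              (λ x S → h x (l ∷ S)))) ⟩
      P + (ΣSublists (suc n) L (λ S → when (p (l ∷ S)) (ΣChoices S (λ x S′ → h x (l ∷ S′)))) + R)
        ≈⟨ +-assoc _ _ _ ⟨
      P + ΣSublists (suc n) L (λ S → when (p (l ∷ S)) (ΣChoices S (λ x S′ → h x (l ∷ S′)))) + R
        ≈⟨ +-congʳ (ΣSublists-+ (suc n) L _ _) ⟨
      ΣSublists (suc n) L (λ S → when (p (l ∷ S)) (h l S)
                               + when (p (l ∷ S)) (ΣChoices S (λ x S′ → h x (l ∷ S′)))) + R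
        ≈⟨ +-congʳ (ΣSublists-≈ (suc n) L (λ S → when-+ (p (l ∷ S)) _ _)) ⟨
      ΣSublists (suc n) L (λ S → when (p (l ∷ S)) (h l S + ΣChoices S (λ x S′ → h x (l ∷ S′)))) + R ∎
      where
      P R : A
      P = ΣSublists (suc n) L (λ S → when (p (l ∷ S)) (h l S))
      R = ΣSublists (suc (suc n)) L (λ S → when (p S) (ΣChoices S h))
      dup : ∀ x w → p (l ∷ x ∷ x ∷ w) ≡ false
      dup x w = ≡.trans (p-↭ (↭-trans (Perm.swap l x Perm.refl) (Perm.prep x (Perm.swap l x Perm.refl))))
                        (p-dup x (l ∷ w))

    -- A word without repetition is an ordering of its set of letters. The predicate is arbitrary
    -- because the induction replaces `p` by `p ∘ (x ∷_)`, which is still invariant and still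
    -- rejects repeated letters.
    ∑-words : (p : List X → Bool) → (∀ {v w} → v ↭ w → p v ≡ p w) →
      (∀ x w → p (x ∷ x ∷ w) ≡ false) → ∀ n L (f : List X → A) →
      ∑ (words n L) (λ w → when (p w) (f w)) ≈
      ΣSublists n L (λ S → when (p S) (ΣArrangements n S f))
    ∑-words p p-↭ p-dup zero    L f = +-identityʳ _
    ∑-words p p-↭ p-dup (suc n) L f = begin
      ∑ (words (suc n) L) (λ w → when (p w) (f w))
        ≈⟨ ∑-words-suc n L _ ⟩
      ∑ L (λ x → ∑ (words n L) (λ w → when (p (x ∷ w)) (f (x ∷ w))))
        ≈⟨ ∑-cong L (λ x → ∑-words (p ∘ (x ∷_)) (p-↭ ∘ Perm.prep x) (dup x) n L (f ∘ (x ∷_))) ⟩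
      ∑ L (λ x → ΣSublists n L (λ S → when (p (x ∷ S)) (ΣArrangements n S (f ∘ (x ∷_)))))
        ≈⟨ ∑-ΣSublists p p-↭ p-dup n L _ ⟩
      ΣSublists (suc n) L (λ S → when (p S) (ΣArrangements (suc n) S f)) ∎
      where
      dup : ∀ l x w → p (l ∷ x ∷ x ∷ w) ≡ false
      dup l x w = ≡.trans (p-↭ (↭-trans (Perm.swap l x Perm.refl) (Perm.prep x (Perm.swap l x Perm.refl))))
                          (p-dup x (l ∷ w))

  -- The sum over the sets with exactly one of i and -i for each i from 1 to `n`. The new letter
  -- goes to the front when negative and to the back when positive, which keeps the list increasing.
  ΣLetterSets : ℕ → (List ℤ → A) → A
  ΣLetterSets zero    g = g []
  ΣLetterSets (suc n) g =
    ΣLetterSets n (λ S → g (-[1+ n ] ∷ S)) + ΣLetterSets n (λ S → g (S ∷ʳ + suc n))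

  ΣLetterSets-cong : ∀ n {g g′ : List ℤ → A} → (∀ S → LetterSet n S → g S ≈ g′ S) →
                     ΣLetterSets n g ≈ ΣLetterSets n g′
  ΣLetterSets-cong zero    eq = eq [] letterSet-[]
  ΣLetterSets-cong (suc n) eq =
    +-cong (ΣLetterSets-cong n (λ S S-ok → eq _ (letterSet-neg S-ok)))
           (ΣLetterSets-cong n (λ S S-ok → eq _ (letterSet-pos S-ok)))

  ΣLetterSets-+ : ∀ n (g g′ : List ℤ → A) →
    ΣLetterSets n (λ S → g S + g′ S) ≈ ΣLetterSets n g + ΣLetterSets n g′
  ΣLetterSets-+ zero    g g′ = C.refl
  ΣLetterSets-+ (suc n) g g′ =
    C.trans (+-cong (ΣLetterSets-+ n _ _) (ΣLetterSets-+ n _ _)) (interchange _ _ _ _)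

  private
    guarded : (List ℤ → A) → List ℤ → A
    guarded g S = when (absDistinct S) (g S)

  -- The three terms are the subsequences containing -(n+1), those containing n+1, and those
  -- containing neither. Those containing both repeat an absolute value, and the guard annihilates
  -- them in `no-top`.
  ΣSublists-alphabet-suc : ∀ k n (g : List ℤ → A) →
    ΣSublists (suc k) (alphabet (suc n)) (guarded g) ≈
    ΣSublists k (alphabet n) (guarded (λ S → g (-[1+ n ] ∷ S)))
      + (ΣSublists k (alphabet n) (guarded (λ S → g (S ∷ʳ + suc n)))
         + ΣSublists (suc k) (alphabet n) (guarded g))
  ΣSublists-alphabet-suc k n g =
    C.trans (C.reflexive (≡.cong (λ L → ΣSublists (suc k) L (guarded g)) (alphabet-suc n)))
      (+-cong (C.trans (no-top k) head≈)
              (C.trans (ΣSublists-∷ʳ k (alphabet n) (+ suc n) (guarded g)) (+-congʳ last≈)))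
    where
    head≈ : ΣSublists k (alphabet n) (λ S → guarded g (-[1+ n ] ∷ S)) ≈
            ΣSublists k (alphabet n) (guarded (λ S → g (-[1+ n ] ∷ S)))
    head≈ = ΣSublists-cong k (alphabet n) (alphabet-bounded n) (λ S bounded →
      C.reflexive (≡.cong (λ b → when b (g (-[1+ n ] ∷ S))) (absDistinct-new -[1+ n ] refl bounded)))

    last≈ : ΣSublists k (alphabet n) (λ S → guarded g (S ∷ʳ + suc n)) ≈
            ΣSublists k (alphabet n) (guarded (λ S → g (S ∷ʳ + suc n)))
    last≈ = ΣSublists-cong k (alphabet n) (alphabet-bounded n) (λ S bounded →
      C.reflexive (≡.cong (λ b → when b (g (S ∷ʳ + suc n)))
        (≡.trans (absDistinct-↭ (↭-sym (↭ₚ.∷↭∷ʳ (+ suc n) S)))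
                 (absDistinct-new (+ suc n) refl bounded))))

    no-top : ∀ k → ΣSublists k (alphabet n ∷ʳ + suc n) (λ S → guarded g (-[1+ n ] ∷ S)) ≈
                   ΣSublists k (alphabet n) (λ S → guarded g (-[1+ n ] ∷ S))
    no-top zero    = C.refl
    no-top (suc k) = begin
      ΣSublists (suc k) (alphabet n ∷ʳ + suc n) (λ S → guarded g (-[1+ n ] ∷ S))
        ≈⟨ ΣSublists-∷ʳ k (alphabet n) (+ suc n) _ ⟩
      ΣSublists k (alphabet n) (λ S → guarded g (-[1+ n ] ∷ (S ∷ʳ + suc n)))
        + ΣSublists (suc k) (alphabet n) (λ S → guarded g (-[1+ n ] ∷ S))
        ≈⟨ +-congʳ (ΣSublists-≈ k (alphabet n) (λ S →
             C.reflexive (≡.cong (λ b → when b (g (-[1+ n ] ∷ (S ∷ʳ + suc n))))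
               (≡.trans (absDistinct-↭ (Perm.prep -[1+ n ] (↭-sym (↭ₚ.∷↭∷ʳ (+ suc n) S))))
                        (absDistinct-repeat -[1+ n ] (+ suc n) S refl))))) ⟩
      ΣSublists k (alphabet n) (λ _ → 0#)
        + ΣSublists (suc k) (alphabet n) (λ S → guarded g (-[1+ n ] ∷ S))
        ≈⟨ C.trans (+-congʳ (ΣSublists-0 k (alphabet n))) (+-identityˡ _) ⟩
      ΣSublists (suc k) (alphabet n) (λ S → guarded g (-[1+ n ] ∷ S)) ∎

  -- Pigeonhole: there are only `n` absolute values to share among `k` letters. This removes the
  -- third term of the preceding recursion when all `n + 1` absolute values have to occur.
  ΣSublists-alphabet-> : ∀ k n (g : List ℤ → A) → n < k →
                         ΣSublists k (alphabet n) (guarded g) ≈ 0#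
  ΣSublists-alphabet-> (suc k) zero    g _         = C.refl
  ΣSublists-alphabet-> (suc k) (suc n) g (s≤s n<k) = C.trans (ΣSublists-alphabet-suc k n g)
    (C.trans (+-cong (ΣSublists-alphabet-> k n _ n<k)
               (C.trans (+-cong (ΣSublists-alphabet-> k n _ n<k)
                                (ΣSublists-alphabet-> (suc k) n g (ℕₚ.m<n⇒m<1+n n<k)))
                        (+-identityˡ 0#)))
             (+-identityˡ 0#))

  ΣSublists-alphabet : ∀ n (g : List ℤ → A) →
                       ΣSublists n (alphabet n) (guarded g) ≈ ΣLetterSets n g
  ΣSublists-alphabet zero    g = C.refl
  ΣSublists-alphabet (suc n) g = C.trans (ΣSublists-alphabet-suc n n g)
    (+-cong (ΣSublists-alphabet n _)
      (C.trans (+-cong (ΣSublists-alphabet n _) (ΣSublists-alphabet-> (suc n) n g ℕₚ.≤-refl))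
               (+-identityʳ _)))

  -- The filter in `B` looks only at the set of letters of a word, so it can be moved from the words
  -- to the subsequences of the alphabet.
  ∑-B : ∀ n (f : List ℤ → A) → ∑ (B n) f ≈ ΣLetterSets n (λ S → ΣArrangements n S f)
  ∑-B n f = begin
    ∑ (B n) f
      ≈⟨ ∑-filterB absDistinct (words n (alphabet n)) f ⟩
    ∑ (words n (alphabet n)) (λ w → when (absDistinct w) (f w))
      ≈⟨ ∑-words absDistinct absDistinct-↭ (λ x w → absDistinct-repeat x x w refl)
           n (alphabet n) f ⟩
    ΣSublists n (alphabet n) (guarded (λ S → ΣArrangements n S f))
      ≈⟨ ΣSublists-alphabet n _ ⟩
    ΣLetterSets n (λ S → ΣArrangements n S f) ∎

-- The weight enumerator as a lattice path sum

module WeightedSums {A : Set} {_∼_ : Rel A 0ℓ} (O : Ops A) (lawful : Lawful O _∼_) where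

  open Sums O lawful
  open Enumeration O lawful
  open CommutativeRing commutativeRing hiding (refl; sym; trans; zero)
  private module C = CommutativeRing commutativeRing
  open SetoidReasoning setoid
  open SemiringSolver commutativeSemiring using (solve; _:=_; _:+_; _:*_)
  open import Algebra.Properties.Group +-group using (∙-cancelʳ)

  infixr 8 _^_
  _^_ : A → ℕ → A
  _^_ = pow O

  ^-+ : ∀ a m n → a ^ (m ℕ.+ n) ≈ a ^ m * a ^ n
  ^-+ a zero    n = C.sym (*-identityˡ _)
  ^-+ a (suc m) n = begin
    a ^ (m ℕ.+ n) * a    ≈⟨ *-congʳ (^-+ a m n) ⟩
    a ^ m * a ^ n * a    ≈⟨ solve 3 (λ x y z → x :* y :* z := x :* z :* y) C.refl _ _ _ ⟩
    a ^ m * a * a ^ n    ∎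

  ^-≡ : ∀ a {m n} → m ≡ n → a ^ m ≈ a ^ n
  ^-≡ a eq = C.reflexive (≡.cong (a ^_) eq)

  module Lattice (α β : ℕ → ℕ → A) where

    -- The sum over paths of `n` steps from the origin, each weighted by its steps and by `h` at its
    -- end point; a step leads from (m , k) to (m+1 , k) with weight `α m k` or to (m , k+1) with
    -- weight `β m k`. The last step is absorbed into `h`, which is the form that the insertion of
    -- one more letter produces.
    lattice : ℕ → (ℕ → ℕ → A) → A
    lattice zero    h = h 0 0
    lattice (suc n) h = lattice n (λ m k → α m k * h (suc m) k + β m k * h m (suc k))

    path : ℕ → ℕ → A
    path zero    zero    = 1#
    path (suc m) zero    = path m 0 * α m 0
    path zero    (suc k) = path 0 k * β 0 k
    path (suc m) (suc k) = path m (suc k) * α m (suc k) + path (suc m) k * β (suc m) k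

    private
      -- The paths to a point, sorted by the direction of their last step. The zeros on the border
      -- give all points other than the origin one common recursion.
      left right : ℕ → ℕ → A
      left zero    k = 0#
      left (suc m) k = path m k * α m k
      right m zero    = 0#
      right m (suc k) = path m k * β m k

      path-suc : ∀ m k {n} → m ℕ.+ k ≡ suc n → path m k ≈ left m k + right m k
      path-suc (suc m) zero    _ = C.sym (+-identityʳ _)
      path-suc zero    (suc k) _ = C.sym (+-identityˡ _)
      path-suc (suc m) (suc k) _ = C.refl

      conv-left : ∀ n (h : ℕ → ℕ → A) → conv (suc n) (λ m k → left m k * h m k) ≈
                          conv n (λ m k → path m k * α m k * h (suc m) k)
      conv-left n h = C.trans (+-congʳ (zeroˡ _)) (+-identityˡ _)

      conv-right : ∀ n (h : ℕ → ℕ → A) → conv (suc n) (λ m k → right m k * h m k) ≈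
                           conv n (λ m k → path m k * β m k * h m (suc k))
      conv-right n h = C.trans (conv-last n (λ m k → right m k * h m k)) (C.trans (+-congˡ (zeroˡ _)) (+-identityʳ _))

    lattice≈conv : ∀ n h → lattice n h ≈ conv n (λ m k → path m k * h m k)
    lattice≈conv zero    h = C.sym (*-identityˡ _)
    lattice≈conv (suc n) h = begin
      lattice n (λ m k → α m k * h (suc m) k + β m k * h m (suc k))
        ≈⟨ lattice≈conv n _ ⟩
      conv n (λ m k → path m k * (α m k * h (suc m) k + β m k * h m (suc k)))
        ≈⟨ conv-cong n (λ m k _ → C.trans (distribˡ _ _ _)
             (C.sym (+-cong (*-assoc _ _ _) (*-assoc _ _ _)))) ⟩
      conv n (λ m k → path m k * α m k * h (suc m) k + path m k * β m k * h m (suc k))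
        ≈⟨ conv-+ n _ _ ⟩
      conv n (λ m k → path m k * α m k * h (suc m) k)
        + conv n (λ m k → path m k * β m k * h m (suc k))
        ≈⟨ +-cong (conv-left n h) (conv-right n h) ⟨
      conv (suc n) (λ m k → left m k * h m k) + conv (suc n) (λ m k → right m k * h m k)
        ≈⟨ conv-+ (suc n) (λ m k → left m k * h m k) (λ m k → right m k * h m k) ⟨
      conv (suc n) (λ m k → left m k * h m k + right m k * h m k)
        ≈⟨ conv-cong (suc n) (λ m k eq →
             C.trans (*-congʳ (path-suc m k eq)) (distribʳ (h m k) _ _)) ⟨
      conv (suc n) (λ m k → path m k * h m k) ∎

  -- Gaussian binomials and the inversions of desarrangements

  module Inversions (q : A) where

    open Lattice (λ _ _ → 1#) (λ m _ → q ^ m) public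
      using () renaming (lattice to binSum; path to bin; lattice≈conv to binSum≈conv)

    qInt qFact : ℕ → A
    qInt zero     = 0#
    qInt (suc n)  = 1# + q * qInt n
    qFact zero    = 1#
    qFact (suc n) = qInt (suc n) * qFact n

    -- Letters are inserted in decreasing order. A new least letter causes no inversion when it
    -- joins `V`, and one with each letter of `V` when it joins `C`; these are the step weights 1
    -- and `q ^ m` of `binSum`.
    ΣSplits-crossInv : ∀ {S} → Sorted S → ∀ h →
      ΣSplits S (λ V C → q ^ crossInv V C * h (length V) (length C)) ≈ binSum (length S) h
    ΣSplits-crossInv []                   h = *-identityˡ _
    ΣSplits-crossInv {a ∷ S} (a<S ∷ sorted) h = begin
      ΣSplits S (λ V C → q ^ (below a C ℕ.+ crossInv V C) * h (suc (length V)) (length C))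
        + ΣSplits S (λ V C → q ^ crossInv V (a ∷ C) * h (length V) (suc (length C)))
        ≈⟨ ΣSplits-+ S _ _ ⟨
      ΣSplits S (λ V C → q ^ (below a C ℕ.+ crossInv V C) * h (suc (length V)) (length C)
                       + q ^ crossInv V (a ∷ C) * h (length V) (suc (length C)))
        ≈⟨ ΣSplits-cong S step ⟩
      ΣSplits S (λ V C → q ^ crossInv V C * h′ (length V) (length C))
        ≈⟨ ΣSplits-crossInv sorted h′ ⟩
      binSum (length S) h′ ∎
      where
      h′ : ℕ → ℕ → A
      h′ m k = 1# * h (suc m) k + q ^ m * h m (suc k)
      step : ∀ V C → Interleaving V C S →
        q ^ (below a C ℕ.+ crossInv V C) * h (suc (length V)) (length C)
          + q ^ crossInv V (a ∷ C) * h (length V) (suc (length C))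
        ≈ q ^ crossInv V C * h′ (length V) (length C)
      step V C i with interleaving-All i a<S
      ... | a<V , a<C = begin
        q ^ (below a C ℕ.+ crossInv V C) * _ + q ^ crossInv V (a ∷ C) * _
          ≈⟨ +-cong (*-cong (^-≡ q (≡.cong (ℕ._+ crossInv V C) (below-none a<C)))
                            (C.sym (*-identityˡ _)))
                    (*-congʳ (C.trans (^-≡ q (crossInv-leastʳ V C a<V)) (^-+ q (length V) _))) ⟩
        q ^ crossInv V C * (1# * _) + q ^ length V * q ^ crossInv V C * _
          ≈⟨ solve 4 (λ x y z w → x :* y :+ z :* x :* w := x :* (y :+ z :* w)) C.refl _ _ _ _ ⟩
        q ^ crossInv V C * h′ (length V) (length C) ∎

    -- The letters of an increasing list have 0, 1, 2, ... smaller letters.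
    ΣChoices-below : ∀ {S} → Sorted S → ΣChoices S (λ x S′ → q ^ below x S′) ≈ qInt (length S)
    ΣChoices-below []                     = C.refl
    ΣChoices-below {a ∷ S} (a<S ∷ sorted) = +-cong (^-≡ q (below-none a<S)) (begin
      ΣChoices S (λ x S′ → q ^ below x (a ∷ S′))
        ≈⟨ ΣChoices-cong S (λ x S′ i → C.trans
             (^-≡ q (below-∷-> S′ (All.head (proj₁ (interleaving-All i a<S))))) (*-comm _ q)) ⟩
      ΣChoices S (λ x S′ → q * q ^ below x S′)
        ≈⟨ ΣChoices-*ˡ S q _ ⟨
      q * ΣChoices S (λ x S′ → q ^ below x S′)
        ≈⟨ *-congˡ (ΣChoices-below sorted) ⟩
      q * qInt (length S) ∎)

    private
      rest-size : ∀ {x S′ S n} → Interleaving (x ∷ []) S′ S → length S ≡ suc n → length S′ ≡ n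
      rest-size i size = ℕₚ.suc-injective (≡.trans (interleaving-length i) size)

    -- The inversions caused by the first letter depend only on the set of the letters that follow,
    -- so their power of `q` leaves the sum.
    ΣArrangements-∷ : ∀ n S′ x (f : List ℤ → A) → length S′ ≡ n →
      ΣArrangements n S′ (λ w → q ^ invStat (x ∷ w) * f w) ≈
      q ^ below x S′ * ΣArrangements n S′ (λ w → q ^ invStat w * f w)
    ΣArrangements-∷ n S′ x f size = begin
      ΣArrangements n S′ (λ w → q ^ (below x w ℕ.+ invStat w) * f w)
        ≈⟨ ΣArrangements-cong n S′ size (λ w w↭S′ → C.trans
             (*-congʳ (C.trans (^-≡ q (≡.cong (ℕ._+ invStat w) (count-↭ (_<ᵇℤ x) w↭S′)))
                               (^-+ q (below x S′) (invStat w))))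
             (*-assoc _ _ _)) ⟩
      ΣArrangements n S′ (λ w → q ^ below x S′ * (q ^ invStat w * f w))
        ≈⟨ ΣArrangements-*ˡ n S′ _ _ ⟨
      q ^ below x S′ * ΣArrangements n S′ (λ w → q ^ invStat w * f w) ∎

    ΣArrangements-inv : ∀ n {S} → Sorted S → length S ≡ n →
      ΣArrangements n S (λ w → q ^ invStat w * 1#) ≈ qFact n
    ΣArrangements-inv zero        sorted size = *-identityʳ _
    ΣArrangements-inv (suc n) {S} sorted size = begin
      ΣChoices S (λ x S′ → ΣArrangements n S′ (λ w → q ^ invStat (x ∷ w) * 1#))
        ≈⟨ ΣChoices-cong S (λ x S′ i → C.trans (ΣArrangements-∷ n S′ x (λ _ → 1#) (rest-size i size))
             (*-congˡ (ΣArrangements-inv n (proj₂ (interleaving-Sorted i sorted)) (rest-size i size)))) ⟩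
      ΣChoices S (λ x S′ → q ^ below x S′ * qFact n)
        ≈⟨ ΣChoices-*ʳ S _ _ ⟨
      ΣChoices S (λ x S′ → q ^ below x S′) * qFact n
        ≈⟨ *-congʳ (ΣChoices-below sorted) ⟩
      qInt (length S) * qFact n
        ≡⟨ ≡.cong (λ m → qInt m * qFact n) size ⟩
      qFact (suc n) ∎

    -- A nonempty V is determined by its least element x and the rest of V.
    ΣSplits-least : ∀ {S} → Sorted S → ∀ (g : List ℤ → List ℤ → A) →
      ΣSplits S (λ V C → when (not (null V)) (g V C)) ≈
      ΣChoices S (λ x S′ → ΣSplits S′ (λ V C → when (precedes x V) (g (x ∷ V) C)))
    ΣSplits-least []                     g = C.refl
    ΣSplits-least {a ∷ S} (a<S ∷ sorted) g = +-cong
      (ΣSplits-cong S (λ V C i → C.reflexive (≡.cong (λ b → when b (g (a ∷ V) C))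
        (≡.sym (precedes-least (proj₁ (interleaving-All i a<S)))))))
      (begin
        ΣSplits S (λ V C → when (not (null V)) (g V (a ∷ C)))
          ≈⟨ ΣSplits-least sorted _ ⟩
        ΣChoices S (λ x S′ → ΣSplits S′ (λ V C → when (precedes x V) (g (x ∷ V) (a ∷ C))))
          ≈⟨ ΣChoices-cong S (λ x S′ i → C.trans (+-congʳ (C.trans
               (ΣSplits-cong S′ (λ V C _ → C.reflexive (≡.cong (λ b → when b (g (x ∷ a ∷ V) C))
                 (≡.cong not (<ᵇℤ-true (All.head (proj₁ (interleaving-All i a<S))))))))
               (ΣSplits-0 S′))) (+-identityˡ _)) ⟨
        ΣChoices S (λ x S′ → ΣSplits (a ∷ S′) (λ V C → when (precedes x V) (g (x ∷ V) C))) ∎)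

    desarrSum : List ℤ → A
    desarrSum S = ΣArrangements (length S) S (λ w → when (isDesarr w) (q ^ invStat w))

    -- Induction on the first letter. Words with empty stem are the desarrangements and give the
    -- term `V` = `[]`; in any other word the first letter `x` is the least letter of the stem. The
    -- statement is made for all `φ` because deleting `x` turns `φ` into `ψ x`, which also tests
    -- whether `x` may stand before the remaining stem.
    ΣArrangements-stem : ∀ n {S} → Sorted S → length S ≡ n → ∀ (φ : List ℤ → A) →
      ΣArrangements n S (λ w → q ^ invStat w * φ (stem w)) ≈
      ΣSplits S (λ V C → q ^ crossInv V C * (φ V * desarrSum C))
    ΣArrangements-stem zero    {[]} sorted size φ = *-congˡ (C.sym (*-identityʳ _))
    ΣArrangements-stem (suc n) {S}  sorted size φ = begin
      ΣArrangements (suc n) S (λ w → q ^ invStat w * φ (stem w))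
        ≈⟨ ΣArrangements-cong (suc n) S size (λ w _ → by-stem w) ⟩
      ΣArrangements (suc n) S (λ w → φ [] * when (isDesarr w) (q ^ invStat w)
                                   + q ^ invStat w * φ⁺ (stem w))
        ≈⟨ ΣArrangements-+ (suc n) S (λ w → φ [] * when (isDesarr w) (q ^ invStat w))
             (λ w → q ^ invStat w * φ⁺ (stem w)) ⟩
      ΣArrangements (suc n) S (λ w → φ [] * when (isDesarr w) (q ^ invStat w))
        + ΣArrangements (suc n) S (λ w → q ^ invStat w * φ⁺ (stem w))
        ≈⟨ +-cong empty-stem (ΣChoices-cong S first-letter) ⟩
      g [] S + ΣChoices S (λ x S′ → ΣSplits S′ (λ V C → when (precedes x V) (g (x ∷ V) C)))
        ≈⟨ +-congˡ (ΣSplits-least sorted g) ⟨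
      g [] S + ΣSplits S (λ V C → when (not (null V)) (g V C))
        ≈⟨ ΣSplits-null S g ⟨
      ΣSplits S g ∎
      where
      g : List ℤ → List ℤ → A
      g V C = q ^ crossInv V C * (φ V * desarrSum C)

      φ⁺ : List ℤ → A
      φ⁺ V = when (not (null V)) (φ V)

      ψ : ℤ → List ℤ → A
      ψ x V = when (precedes x V) (φ (x ∷ V))

      by-stem : ∀ w → q ^ invStat w * φ (stem w) ≈
                φ [] * when (isDesarr w) (q ^ invStat w) + q ^ invStat w * φ⁺ (stem w)
      by-stem w rewrite isDesarr≡null-stem w with stem w
      ... | []    = C.trans (*-comm _ _) (C.sym (C.trans (+-congˡ (zeroʳ _)) (+-identityʳ _)))
      ... | _ ∷ _ = C.sym (C.trans (+-congʳ (zeroʳ _)) (+-identityˡ _))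

      empty-stem : ΣArrangements (suc n) S (λ w → φ [] * when (isDesarr w) (q ^ invStat w)) ≈ g [] S
      empty-stem = begin
        ΣArrangements (suc n) S (λ w → φ [] * when (isDesarr w) (q ^ invStat w))
          ≈⟨ ΣArrangements-*ˡ (suc n) S (φ []) (λ w → when (isDesarr w) (q ^ invStat w)) ⟨
        φ [] * ΣArrangements (suc n) S (λ w → when (isDesarr w) (q ^ invStat w))
          ≡⟨ ≡.cong (λ m → φ [] * ΣArrangements m S _) size ⟨
        φ [] * desarrSum S
          ≈⟨ *-identityˡ _ ⟨
        g [] S ∎

      φ⁺-stem-∷ : ∀ x w → φ⁺ (stem (x ∷ w)) ≡ ψ x (stem w)
      φ⁺-stem-∷ x w rewrite stem-∷ x w with precedes x (stem w)
      ... | true  = refl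
      ... | false = refl

      first-letter : ∀ x S′ → Interleaving (x ∷ []) S′ S →
        ΣArrangements n S′ (λ w → q ^ invStat (x ∷ w) * φ⁺ (stem (x ∷ w))) ≈
        ΣSplits S′ (λ V C → when (precedes x V) (g (x ∷ V) C))
      first-letter x S′ i = begin
        ΣArrangements n S′ (λ w → q ^ invStat (x ∷ w) * φ⁺ (stem (x ∷ w)))
          ≈⟨ ΣArrangements-cong n S′ (rest-size i size) (λ w _ →
               *-congˡ (C.reflexive (φ⁺-stem-∷ x w))) ⟩
        ΣArrangements n S′ (λ w → q ^ invStat (x ∷ w) * ψ x (stem w))
          ≈⟨ ΣArrangements-∷ n S′ x (ψ x ∘ stem) (rest-size i size) ⟩
        q ^ below x S′ * ΣArrangements n S′ (λ w → q ^ invStat w * ψ x (stem w))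
          ≈⟨ *-congˡ (ΣArrangements-stem n (proj₂ (interleaving-Sorted i sorted)) (rest-size i size) (ψ x)) ⟩
        q ^ below x S′ * ΣSplits S′ (λ V C → q ^ crossInv V C * (ψ x V * desarrSum C))
          ≈⟨ ΣSplits-*ˡ S′ _ _ ⟩
        ΣSplits S′ (λ V C → q ^ below x S′ * (q ^ crossInv V C * (ψ x V * desarrSum C)))
          ≈⟨ ΣSplits-cong S′ (λ V C j → attach V C j) ⟩
        ΣSplits S′ (λ V C → when (precedes x V) (g (x ∷ V) C)) ∎
        where
        attach : ∀ V C → Interleaving V C S′ →
          q ^ below x S′ * (q ^ crossInv V C * (ψ x V * desarrSum C)) ≈
          when (precedes x V) (g (x ∷ V) C)
        attach V C j with precedes x V in x≤V
        ... | false = C.trans (*-congˡ (C.trans (*-congˡ (zeroˡ _)) (zeroʳ _))) (zeroʳ _)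
        ... | true  = begin
          q ^ below x S′ * (q ^ crossInv V C * (φ (x ∷ V) * desarrSum C))
            ≈⟨ *-assoc _ _ _ ⟨
          q ^ below x S′ * q ^ crossInv V C * (φ (x ∷ V) * desarrSum C)
            ≈⟨ *-congʳ (^-+ q (below x S′) (crossInv V C)) ⟨
          q ^ (below x S′ ℕ.+ crossInv V C) * (φ (x ∷ V) * desarrSum C)
            ≈⟨ *-congʳ (^-≡ q (≡.cong (ℕ._+ crossInv V C) below≡)) ⟩
          g (x ∷ V) C ∎
          where
          -- No letter of the increasing list `V` is below `x`, so all letters of `S′` below `x` lie
          -- in `C`.
          below≡ : below x S′ ≡ below x C
          below≡ = ≡.trans (interleaving-count (_<ᵇℤ x) j) (≡.cong (ℕ._+ below x C)
            (precedes⇒below (proj₁ (interleaving-Sorted j (proj₂ (interleaving-Sorted i sorted)))) x≤V))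

    module Desarrangements (K : ℕ → A) (K-conv : ∀ n → conv n (λ m k → bin m k * K k) ≈ qFact n)
      where

      -- Strong induction on the length, with `N` as its bound. Summing over all stems counts all
      -- orderings, so `desarrSum` satisfies the same relation with total `qFact` that `K-conv`
      -- states for `K`. The terms with nonempty stem involve shorter sets, agree by induction, and
      -- cancel.
      desarrSum≈K : ∀ N C → length C < N → Sorted C → desarrSum C ≈ K (length C)
      desarrSum≈K (suc N) C (s≤s ∣C∣≤N) sorted = ∙-cancelʳ _ _ _ (begin
        desarrSum C + ΣSplits C (λ V C′ → when (not (null V)) (g desarrSum V C′))
          ≈⟨ +-congʳ (C.trans (*-identityˡ _) (*-identityˡ _)) ⟨
        g desarrSum [] C + ΣSplits C (λ V C′ → when (not (null V)) (g desarrSum V C′))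
          ≈⟨ ΣSplits-null C (g desarrSum) ⟨
        ΣSplits C (g desarrSum)
          ≈⟨ ΣArrangements-stem (length C) sorted refl (λ _ → 1#) ⟨
        ΣArrangements (length C) C (λ w → q ^ invStat w * 1#)
          ≈⟨ ΣArrangements-inv (length C) sorted refl ⟩
        qFact (length C)
          ≈⟨ K-conv (length C) ⟨
        conv (length C) (λ m k → bin m k * K k)
          ≈⟨ conv-cong (length C) (λ m k _ → *-congˡ (*-identityˡ (K k))) ⟨
        conv (length C) (λ m k → bin m k * (1# * K k))
          ≈⟨ binSum≈conv (length C) _ ⟨
        binSum (length C) (λ m k → 1# * K k)
          ≈⟨ ΣSplits-crossInv sorted _ ⟨
        ΣSplits C (g (K ∘ length))
          ≈⟨ ΣSplits-null C (g (K ∘ length)) ⟩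
        g (K ∘ length) [] C + ΣSplits C (λ V C′ → when (not (null V)) (g (K ∘ length) V C′))
          ≈⟨ +-cong (C.trans (*-identityˡ _) (*-identityˡ _)) (ΣSplits-cong C smaller) ⟩
        K (length C) + ΣSplits C (λ V C′ → when (not (null V)) (g desarrSum V C′)) ∎)
        where
        g : (List ℤ → A) → List ℤ → List ℤ → A
        g κ V C′ = q ^ crossInv V C′ * (1# * κ C′)
        smaller : ∀ V C′ → Interleaving V C′ C →
          when (not (null V)) (g (K ∘ length) V C′) ≈ when (not (null V)) (g desarrSum V C′)
        smaller []      C′ i = C.refl
        smaller (x ∷ V) C′ i = *-congˡ (*-congˡ (C.sym (desarrSum≈K N C′
          (ℕₚ.≤-trans (ℕₚ.≤-trans (s≤s (ℕₚ.m≤n+m (length C′) (length V)))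
                                  (ℕₚ.≤-reflexive (interleaving-length i))) ∣C∣≤N)
          (proj₂ (interleaving-Sorted i sorted)))))

  -- Weights of signed splits and of signed words

  module SignedWords (q Y₀ Y₁ Z : A) where

    open Inversions q

    -- A step inserts a letter of absolute value n = m + k + 1 into V (first weight) or
    -- C (second weight), where |V| = m and |C| = k.  The letter -n has weight qⁿ Z and, in C,
    -- an inversion with each letter of V; the letter n has, in V, one with each letter of C.
    open Lattice (λ m k → q ^ suc (m ℕ.+ k) * Z * Y₁ + q ^ k * Y₀)
                 (λ m k → q ^ suc (m ℕ.+ k) * Z * q ^ m + 1#) public
      using () renaming (lattice to signedSum; path to signedBin; lattice≈conv to signedSum≈conv)

    -- Apart from the power of `q` for the inversions, the weight of a word is one factor fixed by
    -- its letter set and one fixed by its stem.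
    letterWeight stemWeight : List ℤ → A
    letterWeight S = q ^ negAbsSum S * Z ^ negStat S
    stemWeight V = Y₀ ^ posPart V * Y₁ ^ negPart V

    -- Bracketed like `weight`, with which it agrees by definition at the four variables.
    wordWeight : List ℤ → A
    wordWeight w = q ^ len w * (Y₀ ^ pixPlus w * (Y₁ ^ pixMinus w * Z ^ negStat w))

    wordWeight-factor : ∀ w → wordWeight w ≈ letterWeight w * (q ^ invStat w * stemWeight (stem w))
    wordWeight-factor w = begin
      wordWeight w
        ≈⟨ *-congʳ (^-+ q (invStat w) (negAbsSum w)) ⟩
      q ^ invStat w * q ^ negAbsSum w * (Y₀ ^ pixPlus w * (Y₁ ^ pixMinus w * Z ^ negStat w))
        ≈⟨ solve 5 (λ i s a b z → i :* s :* (a :* (b :* z)) := (s :* z) :* (i :* (a :* b)))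
             C.refl _ _ _ _ _ ⟩
      letterWeight w * (q ^ invStat w * stemWeight (stem w)) ∎

    letterWeight-↭ : ∀ {v w} → v ↭ w → letterWeight v ≈ letterWeight w
    letterWeight-↭ p = *-cong (^-≡ q (negAbsSum-↭ p)) (^-≡ Z (negStat-↭ p))

    letterWeight-neg : ∀ n S → letterWeight (-[1+ n ] ∷ S) ≈ letterWeight S * (q ^ suc n * Z)
    letterWeight-neg n S = C.trans (*-congʳ (^-+ q (suc n) (negAbsSum S)))
      (solve 4 (λ a b c d → a :* b :* (c :* d) := b :* c :* (a :* d)) C.refl _ _ _ _)

    letterWeight-pos : ∀ n S → letterWeight (S ∷ʳ + n) ≈ letterWeight S
    letterWeight-pos n S = C.sym (letterWeight-↭ (↭ₚ.∷↭∷ʳ (+ n) S))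

    splitWeight : List ℤ → List ℤ → A
    splitWeight V C = q ^ crossInv V C * stemWeight V

    module _ {n S} (S-ok : LetterSet n S) {V C} (i : Interleaving V C S) where

      private
        -n-1<V : All (-[1+ n ] ℤ.<_) V
        -n-1<V = All.map (∣x∣≤n⇒-n-1<x _) (proj₁ (interleaving-All i (bounded S-ok)))
        -n-1<C : All (-[1+ n ] ℤ.<_) C
        -n-1<C = All.map (∣x∣≤n⇒-n-1<x _) (proj₂ (interleaving-All i (bounded S-ok)))
        V<n+1 : All (ℤ._< + suc n) V
        V<n+1 = All.map (∣x∣≤n⇒x<n+1 _) (proj₁ (interleaving-All i (bounded S-ok)))
        C<n+1 : All (ℤ._< + suc n) C
        C<n+1 = All.map (∣x∣≤n⇒x<n+1 _) (proj₂ (interleaving-All i (bounded S-ok)))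

      splitWeight-neg-stem : splitWeight (-[1+ n ] ∷ V) C ≈ splitWeight V C * Y₁
      splitWeight-neg-stem = C.trans
        (*-congʳ (^-≡ q (≡.cong (ℕ._+ crossInv V C) (below-none -n-1<C))))
        (solve 4 (λ a b c d → a :* (b :* (c :* d)) := a :* (b :* c) :* d) C.refl _ _ _ _)

      splitWeight-neg-rest : splitWeight V (-[1+ n ] ∷ C) ≈ splitWeight V C * q ^ length V
      splitWeight-neg-rest = C.trans
        (*-congʳ (C.trans (^-≡ q (crossInv-leastʳ V C -n-1<V)) (^-+ q (length V) _)))
        (solve 3 (λ a b c → a :* b :* c := b :* c :* a) C.refl _ _ _)

      splitWeight-pos-stem : splitWeight (V ∷ʳ + suc n) C ≈ splitWeight V C * (q ^ length C * Y₀)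
      splitWeight-pos-stem = C.trans
        (*-cong (C.trans (^-≡ q (crossInv-greatestˡ V C C<n+1)) (^-+ q (crossInv V C) _))
                (*-cong (^-≡ Y₀ (posPart-∷ʳ V (suc n))) (^-≡ Y₁ (negPart-∷ʳ V (suc n)))))
        (solve 5 (λ a b c d e → a :* b :* (c :* d :* e) := a :* (c :* e) :* (b :* d))
          C.refl _ _ _ _ _)

      splitWeight-pos-rest : splitWeight V (C ∷ʳ + suc n) ≈ splitWeight V C
      splitWeight-pos-rest = *-congʳ (^-≡ q (crossInv-greatestʳ V C V<n+1))

    length-∷ʳ : ∀ (V : List ℤ) x → length (V ∷ʳ x) ≡ suc (length V)
    length-∷ʳ V x = ≡.trans (length-++ V) (ℕₚ.+-comm (length V) 1)

    -- The letter of absolute value n+1 is negative or positive and lies in `V` or in `C`. Each of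
    -- the four cases multiplies the weight by a factor depending only on the lengths of `V` and
    -- `C`, hence the factors can be absorbed into `h`.
    ΣLetterSets-splitWeight : ∀ n h →
      ΣLetterSets n (λ S → ΣSplits S (λ V C →
        letterWeight S * (splitWeight V C * h (length V) (length C)))) ≈ signedSum n h
    ΣLetterSets-splitWeight zero    h = C.trans
      (*-cong (*-identityˡ _) (C.trans (*-congʳ (C.trans (*-identityˡ _) (*-identityˡ _))) (*-identityˡ _)))
      (*-identityˡ _)
    ΣLetterSets-splitWeight (suc n) h = begin
      ΣLetterSets n (λ S → ΣSplits (-[1+ n ] ∷ S) (G h (-[1+ n ] ∷ S)))
        + ΣLetterSets n (λ S → ΣSplits (S ∷ʳ + suc n) (G h (S ∷ʳ + suc n)))
        ≈⟨ ΣLetterSets-+ n _ _ ⟨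
      ΣLetterSets n (λ S → ΣSplits (-[1+ n ] ∷ S) (G h (-[1+ n ] ∷ S))
                         + ΣSplits (S ∷ʳ + suc n) (G h (S ∷ʳ + suc n)))
        ≈⟨ ΣLetterSets-cong n step ⟩
      ΣLetterSets n (λ S → ΣSplits S (G h′ S))
        ≈⟨ ΣLetterSets-splitWeight n h′ ⟩
      signedSum n h′ ∎
      where
      h′ : ℕ → ℕ → A
      h′ m k = (q ^ suc (m ℕ.+ k) * Z * Y₁ + q ^ k * Y₀) * h (suc m) k
             + (q ^ suc (m ℕ.+ k) * Z * q ^ m + 1#) * h m (suc k)

      G : (ℕ → ℕ → A) → List ℤ → List ℤ → List ℤ → A
      G h S V C = letterWeight S * (splitWeight V C * h (length V) (length C))

      pointwise : ∀ S → LetterSet n S → ∀ V C → Interleaving V C S →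
        (G h (-[1+ n ] ∷ S) (-[1+ n ] ∷ V) C + G h (-[1+ n ] ∷ S) V (-[1+ n ] ∷ C))
        + (G h (S ∷ʳ + suc n) (V ∷ʳ + suc n) C + G h (S ∷ʳ + suc n) V (C ∷ʳ + suc n))
        ≈ G h′ S V C
      pointwise S S-ok V C i
        rewrite length-∷ʳ V (+ suc n) | length-∷ʳ C (+ suc n)
              -- The lattice weights are written with m + k and the inserted letter with `n`; this
              -- equation matches them.
              | ≡.trans (interleaving-length i) (size S-ok) = begin
        _ ≈⟨ +-cong
               (+-cong (*-cong (letterWeight-neg n S) (*-congʳ (splitWeight-neg-stem S-ok i)))
                       (*-cong (letterWeight-neg n S) (*-congʳ (splitWeight-neg-rest S-ok i))))
               (+-cong (*-cong (letterWeight-pos (suc n) S) (*-congʳ (splitWeight-pos-stem S-ok i)))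
                       (*-cong (letterWeight-pos (suc n) S)
                         (*-cong (splitWeight-pos-rest S-ok i) (C.sym (*-identityˡ _))))) ⟩
        (s * (N * Z) * (t * Y₁ * h₁) + s * (N * Z) * (t * qm * h₂))
        + (s * (t * (qk * Y₀) * h₁) + s * (t * (1# * h₂)))
          ≈⟨ solve 10 (λ s t NZ Y₁ Y₀ qm qk h₁ h₂ e →
               (s :* NZ :* (t :* Y₁ :* h₁) :+ s :* NZ :* (t :* qm :* h₂))
               :+ (s :* (t :* (qk :* Y₀) :* h₁) :+ s :* (t :* (e :* h₂)))
               := s :* (t :* ((NZ :* Y₁ :+ qk :* Y₀) :* h₁ :+ (NZ :* qm :+ e) :* h₂)))
               C.refl s t (N * Z) Y₁ Y₀ qm qk h₁ h₂ 1# ⟩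
        s * (t * ((N * Z * Y₁ + qk * Y₀) * h₁ + (N * Z * qm + 1#) * h₂)) ∎
        where
        s t N qm qk h₁ h₂ : A
        s = letterWeight S
        t = splitWeight V C
        N = q ^ suc n
        qm = q ^ length V
        qk = q ^ length C
        h₁ = h (suc (length V)) (length C)
        h₂ = h (length V) (suc (length C))

      step : ∀ S → LetterSet n S →
        ΣSplits (-[1+ n ] ∷ S) (G h (-[1+ n ] ∷ S)) + ΣSplits (S ∷ʳ + suc n) (G h (S ∷ʳ + suc n))
        ≈ ΣSplits S (G h′ S)
      step S S-ok = begin
        ΣSplits (-[1+ n ] ∷ S) (G h (-[1+ n ] ∷ S)) + ΣSplits (S ∷ʳ + suc n) (G h (S ∷ʳ + suc n))
          ≈⟨ +-cong (C.sym (ΣSplits-+ S _ _))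
                    (C.trans (ΣSplits-∷ʳ S (+ suc n) _) (C.sym (ΣSplits-+ S _ _))) ⟩
        _ ≈⟨ ΣSplits-+ S _ _ ⟨
        _ ≈⟨ ΣSplits-cong S (pointwise S S-ok) ⟩
        ΣSplits S (G h′ S) ∎

    module _ (K : ℕ → A) (K-conv : ∀ n → conv n (λ m k → bin m k * K k) ≈ qFact n) where

      open Desarrangements K K-conv

      ∑-wordWeight : ∀ n → ∑ (B n) wordWeight ≈ conv n (λ m k → signedBin m k * K k)
      ∑-wordWeight n = begin
        ∑ (B n) wordWeight
          ≈⟨ ∑-B n wordWeight ⟩
        ΣLetterSets n (λ S → ΣArrangements n S wordWeight)
          ≈⟨ ΣLetterSets-cong n arrangements ⟩
        ΣLetterSets n (λ S → ΣSplits S (λ V C →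
          letterWeight S * (splitWeight V C * K (length C))))
          ≈⟨ ΣLetterSets-splitWeight n (λ _ k → K k) ⟩
        signedSum n (λ _ k → K k)
          ≈⟨ signedSum≈conv n _ ⟩
        conv n (λ m k → signedBin m k * K k) ∎
        where
        arrangements : ∀ S → LetterSet n S → ΣArrangements n S wordWeight ≈
          ΣSplits S (λ V C → letterWeight S * (splitWeight V C * K (length C)))
        arrangements S S-ok = begin
          ΣArrangements n S wordWeight
            ≈⟨ ΣArrangements-cong n S (size S-ok) (λ w w↭S →
                 C.trans (wordWeight-factor w) (*-congʳ (letterWeight-↭ w↭S))) ⟩
          ΣArrangements n S (λ w → letterWeight S * (q ^ invStat w * stemWeight (stem w)))
            ≈⟨ ΣArrangements-*ˡ n S _ _ ⟨
          letterWeight S * ΣArrangements n S (λ w → q ^ invStat w * stemWeight (stem w))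
            ≈⟨ *-congˡ (ΣArrangements-stem n (sorted S-ok) (size S-ok) stemWeight) ⟩
          letterWeight S * ΣSplits S (λ V C → q ^ crossInv V C * (stemWeight V * desarrSum C))
            ≈⟨ ΣSplits-*ˡ S _ _ ⟩
          ΣSplits S (λ V C → letterWeight S * (q ^ crossInv V C * (stemWeight V * desarrSum C)))
            ≈⟨ ΣSplits-cong S (λ V C i → *-congˡ (C.trans (C.sym (*-assoc _ _ _))
                 (*-congˡ (desarrSum≈K _ C ℕₚ.≤-refl (proj₂ (interleaving-Sorted i (sorted S-ok))))))) ⟩
          ΣSplits S (λ V C → letterWeight S * (splitWeight V C * K (length C))) ∎

-- Closed forms and generating functions

module QSeries {A : Set} {_∼_ : Rel A 0ℓ} (O : Ops A) (lawful : Lawful O _∼_) (q Y₀ Y₁ Z : A) where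

  open Sums O lawful
  open Enumeration O lawful
  open WeightedSums O lawful
  open Inversions q using (bin; qInt; qFact)
  open SignedWords q Y₀ Y₁ Z using (signedBin; wordWeight; ∑-wordWeight)
  open CommutativeRing commutativeRing hiding (refl; sym; trans; zero)
  private module C = CommutativeRing commutativeRing
  open SetoidReasoning setoid
  open SemiringSolver commutativeSemiring using (solve; _:=_; _:+_; _:*_)
  open import Algebra.Properties.Ring ring using (-‿distribʳ-*; -‿distribˡ-*; -‿involutive)

  infix 9 1-_
  1-_ : A → A
  1- x = sub O 1# x

  1-‿cong : ∀ {x y} → x ≈ y → 1- x ≈ 1- y
  1-‿cong x≈y = +-congˡ (-‿cong x≈y)

  -- The telescoping behind the q-Pascal rule; the closed forms of `bin`, `signedBin` and `qInt` all
  -- reduce to it.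
  1-‿* : ∀ x y → 1- x + x * 1- y ≈ 1- (x * y)
  1-‿* x y = begin
    1# + - x + x * (1# + - y)         ≈⟨ +-congˡ (distribˡ x 1# (- y)) ⟩
    1# + - x + (x * 1# + x * - y)     ≈⟨ +-congˡ (+-cong (*-identityʳ x) (C.sym (-‿distribʳ-* x y))) ⟩
    1# + - x + (x + - (x * y))        ≈⟨ +-assoc _ _ _ ⟨
    1# + - x + x + - (x * y)          ≈⟨ +-congʳ (+-assoc _ _ _) ⟩
    1# + (- x + x) + - (x * y)        ≈⟨ +-congʳ (+-congˡ (-‿inverseˡ x)) ⟩
    1# + 0# + - (x * y)               ≈⟨ +-congʳ (+-identityʳ 1#) ⟩
    1- (x * y)                        ∎

  1-‿*′ : ∀ x y → 1- y + y * 1- x ≈ 1- (x * y)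
  1-‿*′ x y = C.trans (1-‿* y x) (1-‿cong (*-comm y x))

  poch : A → ℕ → A
  poch a n = prodTo O n (λ i → 1- (a * q ^ i))

  denom numerator : ℕ → A
  denom n = poch (- (Z * q)) n * poch q n
  numerator n = prodTo O n (λ i → Y₀ + q ^ suc i * (Y₁ * Z))

  poch-q-suc : ∀ n → poch q (suc n) ≈ poch q n * 1- (q ^ suc n)
  poch-q-suc n = *-congˡ (1-‿cong (*-comm q _))

  denom-suc : ∀ n → denom (suc n) ≈ denom n * ((1# + Z * q ^ suc n) * 1- (q ^ suc n))
  denom-suc n = begin
    poch (- (Z * q)) n * 1- (- (Z * q) * q ^ n) * poch q (suc n)
      ≈⟨ *-cong (*-congˡ (+-congˡ (C.trans (-‿cong (C.sym (-‿distribˡ-* _ _)))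
           (C.trans (-‿involutive _) (C.trans (*-assoc Z q _) (*-congˡ (*-comm q _)))))))
           (poch-q-suc n) ⟩
    poch (- (Z * q)) n * (1# + Z * q ^ suc n) * (poch q n * 1- (q ^ suc n))
      ≈⟨ solve 4 (λ a b c d → a :* b :* (c :* d) := a :* c :* (b :* d)) C.refl _ _ _ _ ⟩
    denom n * ((1# + Z * q ^ suc n) * 1- (q ^ suc n)) ∎

  ^-suc-+-suc : ∀ m k → q ^ suc (m ℕ.+ suc k) ≈ q ^ suc m * q ^ suc k
  ^-suc-+-suc m k = ^-+ q (suc m) (suc k)

  -- `bin` is the Gaussian binomial coefficient. At an inner point the induction hypotheses give
  -- both predecessors the same factor, and the two remaining brackets telescope.
  bin-poch : ∀ m k → bin m k * (poch q m * poch q k) ≈ poch q (m ℕ.+ k)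
  bin-poch zero    zero    = C.trans (*-identityˡ _) (*-identityˡ _)
  bin-poch (suc m) zero    = begin
    bin m 0 * 1# * (poch q m * 1- (q * q ^ m) * 1#)
      ≈⟨ solve 4 (λ a e b c → a :* e :* (b :* c :* e) := a :* (b :* e) :* c :* e) C.refl _ _ _ _ ⟩
    bin m 0 * (poch q m * 1#) * 1- (q * q ^ m) * 1#
      ≈⟨ *-identityʳ _ ⟩
    bin m 0 * (poch q m * 1#) * 1- (q * q ^ m)
      ≈⟨ *-cong (bin-poch m 0) (1-‿cong (*-congˡ (^-≡ q (≡.sym (ℕₚ.+-identityʳ m))))) ⟩
    poch q (suc (m ℕ.+ 0)) ∎
  bin-poch zero    (suc k) = begin
    bin 0 k * 1# * (1# * (poch q k * 1- (q * q ^ k)))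
      ≈⟨ *-congʳ (*-identityʳ _) ⟩
    bin 0 k * (1# * (poch q k * 1- (q * q ^ k)))
      ≈⟨ solve 4 (λ a e b c → a :* (e :* (b :* c)) := a :* (e :* b) :* c) C.refl _ _ _ _ ⟩
    bin 0 k * (1# * poch q k) * 1- (q * q ^ k)
      ≈⟨ *-congʳ (bin-poch 0 k) ⟩
    poch q (suc k) ∎
  bin-poch (suc m) (suc k) = begin
    (bin m (suc k) * 1# + bin (suc m) k * x) * (poch q (suc m) * poch q (suc k))
      ≈⟨ distribʳ _ _ _ ⟩
    bin m (suc k) * 1# * (poch q (suc m) * poch q (suc k))
      + bin (suc m) k * x * (poch q (suc m) * poch q (suc k))
      ≈⟨ +-cong (*-cong (*-identityʳ _) (*-congʳ (poch-q-suc m))) (*-congˡ (*-congˡ (poch-q-suc k))) ⟩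
    bin m (suc k) * (poch q m * 1- x * poch q (suc k))
      + bin (suc m) k * x * (poch q (suc m) * (poch q k * 1- y))
      ≈⟨ +-cong (solve 4 (λ a b c d → a :* (b :* c :* d) := a :* (b :* d) :* c) C.refl _ _ _ _)
                (solve 5 (λ a x b c d → a :* x :* (b :* (c :* d)) := a :* (b :* c) :* (x :* d))
                  C.refl _ _ _ _ _) ⟩
    bin m (suc k) * (poch q m * poch q (suc k)) * 1- x
      + bin (suc m) k * (poch q (suc m) * poch q k) * (x * 1- y)
      ≈⟨ +-cong (*-congʳ (bin-poch m (suc k)))
                (*-congʳ (C.trans (bin-poch (suc m) k)
                  (C.reflexive (≡.cong (poch q) (≡.sym (ℕₚ.+-suc m k)))))) ⟩
    poch q (m ℕ.+ suc k) * 1- x + poch q (m ℕ.+ suc k) * (x * 1- y)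
      ≈⟨ distribˡ _ _ _ ⟨
    poch q (m ℕ.+ suc k) * (1- x + x * 1- y)
      ≈⟨ *-congˡ (C.trans (1-‿* x y) (1-‿cong (C.sym (^-suc-+-suc m k)))) ⟩
    poch q (m ℕ.+ suc k) * 1- (q ^ suc (m ℕ.+ suc k))
      ≈⟨ poch-q-suc (m ℕ.+ suc k) ⟨
    poch q (suc m ℕ.+ suc k) ∎
    where
    x y : A
    x = q ^ suc m
    y = q ^ suc k

  -- The signed analogue of `bin-poch`. In the step to an inner point the first predecessor supplies
  -- the new factor of `numerator`, so both terms share `denom (m ℕ.+ suc k) * numerator (suc m)`;
  -- what remains is the identity `key`.
  signedBin-denom : ∀ m k → signedBin m k * (denom m * poch q k) ≈ denom (m ℕ.+ k) * numerator m
  signedBin-denom zero    zero    = *-identityˡ _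
  signedBin-denom (suc m) zero    rewrite ℕₚ.+-identityʳ m = begin
    signedBin m 0 * (x * Z * Y₁ + 1# * Y₀) * (denom (suc m) * 1#)
      ≈⟨ *-cong (*-congˡ (C.trans (+-congˡ (*-identityˡ Y₀))
           (solve 4 (λ x z y₁ y₀ → x :* z :* y₁ :+ y₀ := y₀ :+ x :* (y₁ :* z)) C.refl _ _ _ _)))
           (*-congʳ (denom-suc m)) ⟩
    signedBin m 0 * f * (denom m * d * 1#)
      ≈⟨ solve 5 (λ a b c d e → a :* b :* (c :* d :* e) := a :* (c :* e) :* d :* b)
           C.refl _ _ _ _ _ ⟩
    signedBin m 0 * (denom m * 1#) * d * f
      ≈⟨ *-congʳ (*-congʳ (signedBin-denom m 0)) ⟩
    denom (m ℕ.+ 0) * numerator m * d * f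
      ≈⟨ *-congʳ (*-congʳ (*-congʳ (C.reflexive (≡.cong denom (ℕₚ.+-identityʳ m))))) ⟩
    denom m * numerator m * d * f
      ≈⟨ solve 4 (λ a b c d → a :* b :* c :* d := a :* c :* (b :* d)) C.refl _ _ _ _ ⟩
    denom m * d * numerator (suc m)
      ≈⟨ *-congʳ (denom-suc m) ⟨
    denom (suc m) * numerator (suc m) ∎
    where
    x f d : A
    x = q ^ suc m
    f = Y₀ + x * (Y₁ * Z)
    d = (1# + Z * x) * 1- x
  signedBin-denom zero    (suc k) = begin
    signedBin 0 k * (y * Z * 1# + 1#) * (denom 0 * poch q (suc k))
      ≈⟨ *-cong (*-congˡ (C.trans (+-congʳ (C.trans (*-identityʳ _) (*-comm y Z))) (+-comm _ _)))
                (*-congˡ (poch-q-suc k)) ⟩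
    signedBin 0 k * (1# + Z * y) * (denom 0 * (poch q k * 1- y))
      ≈⟨ solve 5 (λ a b c d e → a :* b :* (c :* (d :* e)) := a :* (c :* d) :* (b :* e))
           C.refl _ _ _ _ _ ⟩
    signedBin 0 k * (denom 0 * poch q k) * ((1# + Z * y) * 1- y)
      ≈⟨ *-congʳ (signedBin-denom 0 k) ⟩
    denom k * 1# * ((1# + Z * y) * 1- y)
      ≈⟨ solve 3 (λ a b c → a :* b :* c := a :* c :* b) C.refl _ _ _ ⟩
    denom k * ((1# + Z * y) * 1- y) * 1#
      ≈⟨ *-congʳ (denom-suc k) ⟨
    denom (suc k) * numerator 0 ∎
    where
    y : A
    y = q ^ suc k
  signedBin-denom (suc m) (suc k) = begin
    (signedBin m (suc k) * (q ^ suc (m ℕ.+ suc k) * Z * Y₁ + y * Y₀)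
      + signedBin (suc m) k * (q ^ suc (suc m ℕ.+ k) * Z * x + 1#))
      * (denom (suc m) * poch q (suc k))
      ≈⟨ *-congʳ (+-cong
           (*-congˡ (+-congʳ (*-congʳ (*-congʳ (^-suc-+-suc m k)))))
           (*-congˡ (+-congʳ (*-congʳ (*-congʳ (C.trans
             (^-≡ q (≡.cong suc (≡.sym (ℕₚ.+-suc m k)))) (^-suc-+-suc m k))))))) ⟩
    (signedBin m (suc k) * (x * y * Z * Y₁ + y * Y₀) + signedBin (suc m) k * (x * y * Z * x + 1#))
      * (denom (suc m) * poch q (suc k))
      ≈⟨ distribʳ _ _ _ ⟩
    signedBin m (suc k) * (x * y * Z * Y₁ + y * Y₀) * (denom (suc m) * poch q (suc k))
      + signedBin (suc m) k * (x * y * Z * x + 1#) * (denom (suc m) * poch q (suc k))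
      ≈⟨ +-cong (*-congˡ (*-congʳ (denom-suc m))) (*-congˡ (*-congˡ (poch-q-suc k))) ⟩
    signedBin m (suc k) * (x * y * Z * Y₁ + y * Y₀)
        * (denom m * ((1# + Z * x) * 1- x) * poch q (suc k))
      + signedBin (suc m) k * (x * y * Z * x + 1#) * (denom (suc m) * (poch q k * 1- y))
      ≈⟨ +-cong
           (solve 9 (λ s x y z y₁ y₀ d e p →
             s :* (x :* y :* z :* y₁ :+ y :* y₀) :* (d :* e :* p)
             := s :* (d :* p) :* (y₀ :+ x :* (y₁ :* z)) :* (y :* e)) C.refl _ _ _ _ _ _ _ _ _)
           (solve 5 (λ s b d p r → s :* b :* (d :* (p :* r)) := s :* (d :* p) :* (b :* r))
             C.refl _ _ _ _ _) ⟩
    signedBin m (suc k) * (denom m * poch q (suc k)) * f * (y * ((1# + Z * x) * 1- x))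
      + signedBin (suc m) k * (denom (suc m) * poch q k) * ((x * y * Z * x + 1#) * 1- y)
      ≈⟨ +-cong (*-congʳ (C.trans (*-congʳ (signedBin-denom m (suc k))) (*-assoc _ _ _)))
                (*-congʳ (C.trans (signedBin-denom (suc m) k) (*-congʳ
                  (C.reflexive (≡.cong denom (≡.sym (ℕₚ.+-suc m k))))))) ⟩
    denom (m ℕ.+ suc k) * numerator (suc m) * (y * ((1# + Z * x) * 1- x))
      + denom (m ℕ.+ suc k) * numerator (suc m) * ((x * y * Z * x + 1#) * 1- y)
      ≈⟨ distribˡ _ _ _ ⟨
    denom (m ℕ.+ suc k) * numerator (suc m)
      * (y * ((1# + Z * x) * 1- x) + (x * y * Z * x + 1#) * 1- y)
      ≈⟨ *-congˡ key ⟩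
    denom (m ℕ.+ suc k) * numerator (suc m) * ((1# + Z * (x * y)) * 1- (x * y))
      ≈⟨ solve 3 (λ a b c → a :* b :* c := a :* c :* b) C.refl _ _ _ ⟩
    denom (m ℕ.+ suc k) * ((1# + Z * (x * y)) * 1- (x * y)) * numerator (suc m)
      ≈⟨ *-congʳ (*-congˡ (*-cong (+-congˡ (*-congˡ (^-suc-+-suc m k)))
                                  (1-‿cong (^-suc-+-suc m k)))) ⟨
    denom (m ℕ.+ suc k)
      * ((1# + Z * q ^ suc (m ℕ.+ suc k)) * 1- (q ^ suc (m ℕ.+ suc k))) * numerator (suc m)
      ≈⟨ *-congʳ (denom-suc (m ℕ.+ suc k)) ⟨
    denom (suc m ℕ.+ suc k) * numerator (suc m) ∎
    where
    x y f : A
    x = q ^ suc m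
    y = q ^ suc k
    f = Y₀ + x * (Y₁ * Z)
    key : y * ((1# + Z * x) * 1- x) + (x * y * Z * x + 1#) * 1- y ≈ (1# + Z * (x * y)) * 1- (x * y)
    key = begin
      -- Sorting by powers of `Z` leaves the brackets 1 - y + y(1 - x) and, with factor xy, 1 - x +
      -- x(1 - y); both equal 1 - xy.
      y * ((1# + Z * x) * 1- x) + (x * y * Z * x + 1#) * 1- y
        ≈⟨ solve 6 (λ e x y z p r →
             y :* ((e :+ z :* x) :* p) :+ (x :* y :* z :* x :+ e) :* r
             := e :* (r :+ y :* p) :+ z :* (x :* y) :* (p :+ x :* r)) C.refl 1# x y Z (1- x) (1- y) ⟩
      1# * (1- y + y * 1- x) + Z * (x * y) * (1- x + x * 1- y)
        ≈⟨ +-cong (*-congˡ (1-‿*′ x y)) (*-congˡ (1-‿* x y)) ⟩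
      1# * 1- (x * y) + Z * (x * y) * 1- (x * y)
        ≈⟨ distribʳ _ _ _ ⟨
      (1# + Z * (x * y)) * 1- (x * y) ∎

  qInt-closed : ∀ n → qInt n * 1- q ≈ 1- (q ^ n)
  qInt-closed zero    = C.trans (zeroˡ _) (C.sym (-‿inverseʳ 1#))
  qInt-closed (suc n) = begin
    (1# + q * qInt n) * 1- q
      ≈⟨ distribʳ _ _ _ ⟩
    1# * 1- q + q * qInt n * 1- q
      ≈⟨ +-cong (*-identityˡ _) (C.trans (*-assoc _ _ _) (*-congˡ (qInt-closed n))) ⟩
    1- q + q * 1- (q ^ n)
      ≈⟨ C.trans (1-‿* q (q ^ n)) (1-‿cong (*-comm q _)) ⟩
    1- (q ^ suc n) ∎

  qFact-closed : ∀ n → qFact n * (1- q) ^ n ≈ poch q n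
  qFact-closed zero    = *-identityˡ _
  qFact-closed (suc n) = begin
    qInt (suc n) * qFact n * ((1- q) ^ n * 1- q)
      ≈⟨ solve 4 (λ a b c d → a :* b :* (c :* d) := b :* c :* (a :* d)) C.refl _ _ _ _ ⟩
    qFact n * (1- q) ^ n * (qInt (suc n) * 1- q)
      ≈⟨ *-cong (qFact-closed n) (qInt-closed (suc n)) ⟩
    poch q n * 1- (q ^ suc n)
      ≈⟨ poch-q-suc n ⟨
    poch q (suc n) ∎

  -- Generating functions in u

  open PowerSeries O lawful
  private module S = CommutativeRing (Sums.commutativeRing (psOps O) psLawful)

  linearProduct : ℕ → PS A
  linearProduct N = prodTo (psOps O) N (λ i → linear (q ^ i))

  ^-distrib-* : ∀ a b n → (a * b) ^ n ≈ a ^ n * b ^ n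
  ^-distrib-* a b zero    = C.sym (*-identityˡ 1#)
  ^-distrib-* a b (suc n) = C.trans (*-congʳ (^-distrib-* a b n))
    (solve 4 (λ x y a b → x :* y :* (a :* b) := x :* a :* (y :* b)) C.refl _ _ _ _)

  x-⟨1-y⟩x : ∀ x y → x + - (x * 1- y) ≈ x * y
  x-⟨1-y⟩x x y = begin
    x + - (x * 1- y)             ≈⟨ +-congʳ (lemma) ⟨
    x * y + x * 1- y + - (x * 1- y) ≈⟨ +-assoc _ _ _ ⟩
    x * y + (x * 1- y + - (x * 1- y)) ≈⟨ +-congˡ (-‿inverseʳ _) ⟩
    x * y + 0#                   ≈⟨ +-identityʳ _ ⟩
    x * y                        ∎
    where
    lemma : x * y + x * 1- y ≈ x
    lemma = C.trans (C.sym (distribˡ x y _)) (C.trans (*-congˡ (C.trans (+-comm y _)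
      (C.trans (+-assoc 1# _ y) (C.trans (+-congˡ (-‿inverseˡ y)) (+-identityʳ 1#))))) (*-identityʳ x))

  module _ (e : ℕ → A) (e-inverse : ∀ n → poch q n * e n ≈ 1#) where

    e-0 : e 0 ≈ 1#
    e-0 = C.trans (C.sym (*-identityˡ _)) (e-inverse 0)

    e-suc : ∀ n → e n ≈ e (suc n) * 1- (q ^ suc n)
    e-suc n = begin
      e n                                             ≈⟨ *-identityʳ _ ⟨
      e n * 1#                                        ≈⟨ *-congˡ (e-inverse (suc n)) ⟨
      e n * (poch q (suc n) * e (suc n))              ≈⟨ *-congˡ (*-congʳ (poch-q-suc n)) ⟩
      e n * (poch q n * 1- (q ^ suc n) * e (suc n))
        ≈⟨ solve 4 (λ a b c d → a :* (b :* c :* d) := b :* a :* (d :* c)) C.refl _ _ _ _ ⟩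
      poch q n * e n * (e (suc n) * 1- (q ^ suc n))   ≈⟨ *-congʳ (e-inverse n) ⟩
      1# * (e (suc n) * 1- (q ^ suc n))               ≈⟨ *-identityˡ _ ⟩
      e (suc n) * 1- (q ^ suc n)                      ∎

    -- With e(u) = Σ uⁿ/(q;q)ₙ, the relation (1 - u) e(u) = e(qu) gives
    -- (u;q)_N e(u) = e(q^N u).
    linearProduct⊛e : ∀ N n → (linearProduct N ⊛ e) n ≈ (q ^ N) ^ n * e n
    linearProduct⊛e zero    n       = C.trans (𝟙⊛ e n) (C.sym (C.trans (*-congʳ (1^ n)) (*-identityˡ _)))
      where
      1^ : ∀ n → 1# ^ n ≈ 1#
      1^ zero    = C.refl
      1^ (suc n) = C.trans (*-identityʳ _) (1^ n)
    linearProduct⊛e (suc N) n = C.trans (reorder n) (coefficient n)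
      where
      P : PS A
      P = linearProduct N ⊛ e
      reorder : (linearProduct (suc N) ⊛ e) S.≈ (linear (q ^ N) ⊛ P)
      reorder = S.trans (S.*-congʳ {e} (S.*-comm (linearProduct N) (linear (q ^ N))))
                        (S.*-assoc (linear (q ^ N)) (linearProduct N) e)
      coefficient : ∀ n → (linear (q ^ N) ⊛ P) n ≈ (q ^ suc N) ^ n * e n
      coefficient zero    = C.trans (linear⊛-zero (q ^ N) P) (linearProduct⊛e N 0)
      coefficient (suc n) = begin
        (linear (q ^ N) ⊛ P) (suc n)
          ≈⟨ linear⊛-suc (q ^ N) P n ⟩
        P (suc n) + - (q ^ N * P n)
          ≈⟨ +-cong (linearProduct⊛e N (suc n)) (-‿cong (*-congˡ
               (C.trans (linearProduct⊛e N n) (*-congˡ (e-suc n))))) ⟩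
        Q * e (suc n) + - (q ^ N * ((q ^ N) ^ n * (e (suc n) * 1- (q ^ suc n))))
          ≈⟨ +-congˡ (-‿cong (solve 4 (λ a b c d → a :* (b :* (c :* d)) := b :* a :* c :* d)
               C.refl _ _ _ _)) ⟩
        Q * e (suc n) + - (Q * e (suc n) * 1- (q ^ suc n))
          ≈⟨ x-⟨1-y⟩x _ _ ⟩
        Q * e (suc n) * q ^ suc n
          ≈⟨ solve 3 (λ a b c → a :* b :* c := a :* c :* b) C.refl _ _ _ ⟩
        Q * q ^ suc n * e (suc n)
          ≈⟨ *-congʳ (^-distrib-* (q ^ N) q (suc n)) ⟨
        (q ^ suc N) ^ suc n * e (suc n) ∎
        where
        Q : A
        Q = (q ^ N) ^ suc n

    module _ (t : A) (t-inverse : 1- q * t ≈ 1#)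
             (geom : PS A) (geom-inverse : (linear t ⊛ geom) ≋ 𝟙)
             (U : PS A) (U⊛e : (U ⊛ e) ≋ 𝟙)
             (d : ℕ → A) (d-inverse : ∀ n → denom n * d n ≈ 1#) where

      geom≈power : ∀ n → geom n ≈ t ^ n
      geom≈power zero    = C.trans (C.sym (linear⊛-zero t geom)) (geom-inverse 0)
      geom≈power (suc n) = begin
        geom (suc n)                                       ≈⟨ +-identityʳ _ ⟨
        geom (suc n) + 0#                                  ≈⟨ +-congˡ (-‿inverseˡ _) ⟨
        geom (suc n) + (- (t * geom n) + t * geom n)       ≈⟨ +-assoc _ _ _ ⟨
        geom (suc n) + - (t * geom n) + t * geom n
          ≈⟨ +-congʳ (C.trans (C.sym (linear⊛-suc t geom n)) (geom-inverse (suc n))) ⟩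
        0# + t * geom n                                    ≈⟨ +-identityˡ _ ⟩
        t * geom n                                         ≈⟨ *-comm t _ ⟩
        geom n * t                                         ≈⟨ *-congʳ (geom≈power n) ⟩
        t ^ suc n                                          ∎

      G : PS A
      G = geom ⊛ U

      -- Here `G` is (u;q)_∞ / (1 - u/(1-q)), the product of the first two factors of the right-hand
      -- side of the theorem, so that the sum of `K n` uⁿ / (q;q)ₙ is `G`.
      K : ℕ → A
      K n = poch q n * G n

      poch*geom : ∀ n → poch q n * geom n ≈ qFact n
      poch*geom n = begin
        poch q n * geom n                  ≈⟨ *-cong (C.sym (qFact-closed n)) (geom≈power n) ⟩
        qFact n * (1- q) ^ n * t ^ n       ≈⟨ *-assoc _ _ _ ⟩
        qFact n * ((1- q) ^ n * t ^ n)     ≈⟨ *-congˡ (^-distrib-* (1- q) t n) ⟨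
        qFact n * ((1- q * t) ^ n)         ≈⟨ *-congˡ (^-one n) ⟩
        qFact n * 1#                       ≈⟨ *-identityʳ _ ⟩
        qFact n                            ∎
        where
        ^-one : ∀ n → (1- q * t) ^ n ≈ 1#
        ^-one zero    = C.refl
        ^-one (suc n) = C.trans (*-cong (^-one n) t-inverse) (*-identityˡ 1#)

      -- Division by (q;q)ₙ turns convolution with Gaussian binomials into the product of `e` and
      -- `G`. There `e` cancels `U` and leaves `geom`, whose coefficients are `qFact n` / (q;q)ₙ.
      K-conv : ∀ n → conv n (λ m k → bin m k * K k) ≈ qFact n
      K-conv n = begin
        conv n (λ m k → bin m k * (poch q k * G k))
          ≈⟨ conv-cong n step ⟩
        conv n (λ m k → poch q n * (e m * G k))
          ≈⟨ conv-*ˡ n (poch q n) _ ⟨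
        poch q n * conv n (λ m k → e m * G k)
          ≈⟨ *-congˡ (⊛≈conv e G n) ⟨
        poch q n * (e ⊛ G) n
          ≈⟨ *-congˡ (S.trans (S.*-comm e G) (S.trans (S.*-assoc geom U e)
               (S.trans (S.*-congˡ {geom} U⊛e) (S.*-identityʳ geom))) n) ⟩
        poch q n * geom n
          ≈⟨ poch*geom n ⟩
        qFact n ∎
        where
        step : ∀ m k → m ℕ.+ k ≡ n → bin m k * (poch q k * G k) ≈ poch q n * (e m * G k)
        step m k refl = begin
          bin m k * (poch q k * G k)
            ≈⟨ *-identityʳ _ ⟨
          bin m k * (poch q k * G k) * 1#
            ≈⟨ *-congˡ (e-inverse m) ⟨
          bin m k * (poch q k * G k) * (poch q m * e m)
            ≈⟨ solve 5 (λ a b c d e → a :* (b :* c) :* (d :* e) := a :* (d :* b) :* (e :* c))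
                 C.refl _ _ _ _ _ ⟩
          bin m k * (poch q m * poch q k) * (e m * G k)
            ≈⟨ *-congʳ (bin-poch m k) ⟩
          poch q (m ℕ.+ k) * (e m * G k) ∎

      series : PS A
      series n = numerator n * d n

      -- In `signedBin m k * K k` the factor (q;q)ₖ of `K k` cancels the one in the denominator of
      -- `signedBin`. After division by `denom n` only a function of m times a function of k is
      -- left, and the convolution becomes the product of `series` and `G`.
      generatingFunction : ∀ n → denom n * (geom ⊛ (U ⊛ series)) n ≈ ∑ (B n) wordWeight
      generatingFunction n = begin
        denom n * (geom ⊛ (U ⊛ series)) n
          ≈⟨ *-congˡ (S.trans (S.sym (S.*-assoc geom U series)) (S.*-comm G series) n) ⟩
        denom n * (series ⊛ G) n
          ≈⟨ *-congˡ (⊛≈conv series G n) ⟩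
        denom n * conv n (λ m k → series m * G k)
          ≈⟨ conv-*ˡ n (denom n) _ ⟩
        conv n (λ m k → denom n * (series m * G k))
          ≈⟨ conv-cong n step ⟨
        conv n (λ m k → signedBin m k * K k)
          ≈⟨ ∑-wordWeight K K-conv n ⟨
        ∑ (B n) wordWeight ∎
        where
        step : ∀ m k → m ℕ.+ k ≡ n → signedBin m k * K k ≈ denom n * (series m * G k)
        step m k refl = begin
          signedBin m k * (poch q k * G k)
            ≈⟨ *-identityʳ _ ⟨
          signedBin m k * (poch q k * G k) * 1#
            ≈⟨ *-congˡ (d-inverse m) ⟨
          signedBin m k * (poch q k * G k) * (denom m * d m)
            ≈⟨ solve 5 (λ a b c d e → a :* (b :* c) :* (d :* e) := a :* (d :* b) :* (e :* c))
                 C.refl _ _ _ _ _ ⟩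
          signedBin m k * (denom m * poch q k) * (d m * G k)
            ≈⟨ *-congʳ (signedBin-denom m k) ⟩
          denom (m ℕ.+ k) * numerator m * (d m * G k)
            ≈⟨ solve 4 (λ a b c d → a :* b :* (c :* d) := a :* (b :* c :* d)) C.refl _ _ _ _ ⟩
          denom (m ℕ.+ k) * (series m * G k) ∎

-- The infinite product as a limit of finite products

module Truncation {A : Set} {_∼_ : Rel A 0ℓ} (O : Ops A) (lawful : Lawful O _∼_) where

  open PowerSeries O lawful
  private
    module S = Sums O lawful
    module R = CommutativeRing S.commutativeRing
    module T = Sums (psOps O) psLawful
    module PSR = CommutativeRing T.commutativeRing

  -- Congruence modulo the `N`-th power of the variable.
  AgreeBelow : ℕ → Rel (PS A) 0ℓ
  AgreeBelow N f g = ∀ b → b < N → f b R.≈ g b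

  AgreeBelow-⊛ : ∀ {N f f′} g → AgreeBelow N f f′ → AgreeBelow N (f ⊛ g) (f′ ⊛ g)
  AgreeBelow-⊛ g agree b b<N =
    S.sumTo-cong b (λ k k≤b → R.*-congʳ (agree k (ℕₚ.≤-<-trans k≤b b<N)))

  AgreeBelow-conv : ∀ {N} n {h h′ : ℕ → ℕ → PS A} →
    (∀ m k → AgreeBelow N (h m k) (h′ m k)) → AgreeBelow N (T.conv n h) (T.conv n h′)
  AgreeBelow-conv zero    agree b b<N = agree 0 0 b b<N
  AgreeBelow-conv (suc n) agree b b<N =
    R.+-cong (agree 0 (suc n) b b<N) (AgreeBelow-conv n (λ m k → agree (suc m) k) b b<N)

  var^-vanishes : ∀ N → AgreeBelow N (pow (psOps O) (var O) N) PSR.0#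
  var^-vanishes (suc N) zero    _         = R.zeroʳ _
  var^-vanishes (suc N) (suc b) (s≤s b<N) =
    R.trans (PSR.*-comm (pow (psOps O) (var O) N) (var O) (suc b))
            (R.trans (var⊛-suc (pow (psOps O) (var O) N) b) (var^-vanishes N b b<N))

  var^⊛-vanishes : ∀ N f → AgreeBelow N (pow (psOps O) (var O) N ⊛ f) PSR.0#
  var^⊛-vanishes N f b b<N =
    R.trans (AgreeBelow-⊛ f (var^-vanishes N) b b<N) (PSR.zeroˡ f b)

  module InfiniteProduct (Y₀ Y₁ Z : PS A) where

    open QSeries (psOps O) psLawful (var O) Y₀ Y₁ Z
    private
      q : PS A
      q = var O
      module P = PowerSeries (psOps O) psLawful

    -- The additional factor 1 - q^N u is 1 modulo q^N. Hence the coefficient of q^b is final once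
    -- the b+1 factors with exponents up to b are present, which is where `infiniteProduct` reads
    -- it.
    linearProduct-suc : ∀ N n → AgreeBelow N (linearProduct (suc N) n) (linearProduct N n)
    linearProduct-suc N n b b<N =
      R.trans (P.⊛-comm (linearProduct N) (P.linear (pow (psOps O) q N)) n b) (go n)
      where
      go : ∀ n → (P.linear (pow (psOps O) q N) P.⊛ linearProduct N) n b R.≈ linearProduct N n b
      go zero    = P.linear⊛-zero (pow (psOps O) q N) (linearProduct N) b
      go (suc n) = R.trans (P.linear⊛-suc (pow (psOps O) q N) (linearProduct N) n b)
        (R.trans (R.+-congˡ (R.trans (R.-‿cong (var^⊛-vanishes N (linearProduct N n) b b<N))
                                     -0#≈0#))
                 (R.+-identityʳ _))
        where open import Algebra.Properties.Ring R.ring using (-0#≈0#)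

    linearProduct-stable : ∀ N d n → AgreeBelow N (linearProduct (d ℕ.+ N) n) (linearProduct N n)
    linearProduct-stable N zero    n b b<N = R.refl
    linearProduct-stable N (suc d) n b b<N =
      R.trans (linearProduct-suc (d ℕ.+ N) n b (ℕₚ.<-≤-trans b<N (ℕₚ.m≤n+m N d)))
              (linearProduct-stable N d n b b<N)

    infiniteProduct : PS (PS A)
    infiniteProduct n b = linearProduct (suc b) n b

    infiniteProduct-approx : ∀ N n → AgreeBelow N (infiniteProduct n) (linearProduct N n)
    infiniteProduct-approx N n b b<N = R.sym (R.trans
      (R.reflexive (≡.cong (λ M → linearProduct M n b) (≡.sym (ℕₚ.m∸n+n≡m b<N))))
      (linearProduct-stable (suc b) (N ∸ suc b) n b ℕₚ.≤-refl))

    -- For the coefficient of q^b the product may be cut after N = b+1 factors. Then the left side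
    -- is e(q^N u), whose coefficients of positive degree in u are divisible by q^N and so vanish at
    -- q^b.
    infiniteProduct⊛e : (e : ℕ → PS A) (e-inverse : ∀ n → (poch q n ⊛ e n) PSR.≈ PSR.1#) →
                        (infiniteProduct P.⊛ e) P.≋ P.𝟙
    infiniteProduct⊛e e e-inverse n b = begin
      (infiniteProduct P.⊛ e) n b
        ≈⟨ P.⊛≈conv infiniteProduct e n b ⟩
      T.conv n (λ m k → infiniteProduct m ⊛ e k) b
        ≈⟨ AgreeBelow-conv n (λ m k → AgreeBelow-⊛ (e k) (infiniteProduct-approx (suc b) m)) b ℕₚ.≤-refl ⟩
      T.conv n (λ m k → linearProduct (suc b) m ⊛ e k) b
        ≈⟨ P.⊛≈conv (linearProduct (suc b)) e n b ⟨
      (linearProduct (suc b) P.⊛ e) n b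
        ≈⟨ linearProduct⊛e e e-inverse (suc b) n b ⟩
      (pow (psOps O) (pow (psOps O) q (suc b)) n ⊛ e n) b
        ≈⟨ constant n ⟩
      P.𝟙 n b ∎
      where
      open SetoidReasoning R.setoid
      Q : PS A
      Q = pow (psOps O) q (suc b)
      constant : ∀ n → (pow (psOps O) Q n ⊛ e n) b R.≈ P.𝟙 n b
      constant zero    = R.trans (PSR.*-identityˡ (e 0) b) (e-0 e e-inverse b)
      constant (suc n) = R.trans
        (PSR.trans (PSR.*-congʳ {e (suc n)} (PSR.*-comm (pow (psOps O) Q n) Q))
                   (PSR.*-assoc Q (pow (psOps O) Q n) (e (suc n))) b)
        (var^⊛-vanishes (suc b) (pow (psOps O) Q n ⊛ e (suc n)) b ℕₚ.≤-refl)

-- The ring of series in q, Y₀, Y₁, Z over the integers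

lawful₀ : Lawful ℤOps _≡_
lawful₀ = ℤₚ.+-*-isCommutativeRing

private
  module PS₁ = PowerSeries ℤOps lawful₀
  module PS₂ = PowerSeries O₁ PS₁.psLawful
  module PS₃ = PowerSeries O₂ PS₂.psLawful
  module PS₄ = PowerSeries O₃ PS₃.psLawful
  module PS₅ = PowerSeries O₄ PS₄.psLawful

-- Invertibility descends through the constant terms of the nested series to an integer. There `inv`
-- is the identity, so the condition to check is x x = 1.
inverse₄ : ∀ f → f 0 0 0 0 ≡ + 1 → (f PS₄.⊛ PS₄.inverse f) PS₄.≋ PS₄.𝟙
inverse₄ f eq = PS₄.⊛-inverseʳ f (PS₃.⊛-inverseʳ (f 0) (PS₂.⊛-inverseʳ (f 0 0)
  (PS₁.⊛-inverseʳ (f 0 0 0) (≡.cong (λ x → x ℤ.* x) eq))))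

inverse₅ : ∀ f → f 0 0 0 0 0 ≡ + 1 → (f PS₅.⊛ PS₅.inverse f) PS₅.≋ PS₅.𝟙
inverse₅ f eq = PS₅.⊛-inverseʳ f (inverse₄ (f 0) eq)

-- At index 0 a product of series computes to the product of the constant terms, so the claim
-- reduces to integer arithmetic after rewriting.
qPoch-unit : ∀ a → a 0 0 0 0 ≡ + 0 → ∀ n → qPoch a n 0 0 0 0 ≡ + 1
qPoch-unit a eq zero    = refl
qPoch-unit a eq (suc n) rewrite eq | qPoch-unit a eq n = refl

den-unit : ∀ n → den n 0 0 0 0 ≡ + 1
den-unit n rewrite qPoch-unit (Ops.neg O₄ (Ops.mul O₄ Zv qv)) refl n | qPoch-unit qv refl n = refl

theorem1p2 : (n : ℕ) → lB n ≈₄ Bpoly n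
-- The generic expressions at the four variables unfold to `lB` and `Bpoly`. What is supplied are
-- the inverses of (q;q)ₙ, 1 - q, 1 - u/(1-q) and `den n`, each of constant term 1, and the infinite
-- product.
theorem1p2 = generatingFunction
  (λ n → PS₄.inverse (qPoch qv n)) (λ n → inverse₄ (qPoch qv n) (qPoch-unit qv refl n))
  (PS₄.inverse (1- qv)) (inverse₄ (1- qv) refl)
  geomFactor (inverse₅ (PS₅.linear (PS₄.inverse (1- qv))) refl)
  uqInf (infiniteProduct⊛e (λ n → PS₄.inverse (qPoch qv n))
                            (λ n → inverse₄ (qPoch qv n) (qPoch-unit qv refl n)))
  (λ n → PS₄.inverse (den n)) (λ n → inverse₄ (den n) (den-unit n))
  where
  open QSeries O₄ PS₄.psLawful qv Y₀v Y₁v Zv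
  open Truncation.InfiniteProduct O₃ PS₃.psLawful Y₀v Y₁v Zv
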